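{- Let $n>1$ be an odd integer, $a$ an indeterminate, and let $M=(n+1)/2$ or $M=n-1$. Then, modulo $[n]_{q^2}^2(1-aq^{2n})(a-q^{2n})$, $$\sum_{k=0}^{M}[4k-1]_{q^2}[4k-1]^2\frac{(q^{ -2};q^4)_k^2(q^{ -2}/a;q^4)_k(aq^{ -2};q^4)_k}{(q^4;q^4)_k^2(q^4/a;q^4)_k(aq^4;q^4)_k}q^{4k}\equiv 0.$$
   Context: For an integer $m$ (possibly negative), $[m]=[m]_q=(1-q^m)/(1-q)$ and $[m]_{q^2}=(1-q^{2m})/(1-q^2)$. The $q$-shifted factorial is $(x;q)_0=1$ and $(x;q)_k=(1-x)(1-xq)\cdots(1-xq^{k-1})$ for $k\ge1$. A congruence $A\equiv B$ modulo a polynomial $P$ in $q$ and $a$, for rational functions $A,B$ in $q$ and $a$, means that $A-B$, written as a reduced fraction, has numerator divisible by $P$ and denominator coprime to $P$ (in $\mathbb{Z}[q,a]$, allowing powers of $q$ and $a$ in denominators). -}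

module Defs where

open import Data.Nat as ℕ using (ℕ; zero; suc)
open import Data.Integer as ℤ using (ℤ; +_; -_)
open import Data.List using (List; []; _∷_; _++_; map; concatMap)
open import Data.Product using (Σ; _×_; _,_)
open import Relation.Nullary using (yes; no)
open import Relation.Binary.PropositionalEquality using (_≡_)

-- Laurent polynomials in two indeterminates q, a over ℤ,
-- i.e. elements of ℤ[q, q⁻¹, a, a⁻¹], represented as finite lists of
-- terms  c · q^i · a^j  (i, j ∈ ℤ).  Equality is equality of all
-- coefficients.

record Term : Set where
  constructor tm
  field
    cf : ℤ
    eq : ℤ   -- exponent of q
    ea : ℤ   -- exponent of a

LPoly : Set
LPoly = List Term

coeff : LPoly → ℤ → ℤ → ℤ
coeff [] i j = + 0
coeff (tm c x y ∷ p) i j with x ℤ.≟ i | y ℤ.≟ j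
... | yes _ | yes _ = c ℤ.+ coeff p i j
... | _     | _     = coeff p i j

mon : ℤ → ℤ → ℤ → LPoly
mon c i j = tm c i j ∷ []

one : LPoly
one = mon (+ 1) (+ 0) (+ 0)

infixl 6 _⊕_ _⊖_
infixl 7 _⊗_

_⊕_ : LPoly → LPoly → LPoly
p ⊕ r = p ++ r

neg : LPoly → LPoly
neg = map (λ { (tm c x y) → tm (- c) x y })

_⊖_ : LPoly → LPoly → LPoly
p ⊖ r = p ⊕ neg r

_⊗_ : LPoly → LPoly → LPoly
p ⊗ r = concatMap (λ { (tm c x y) → map (λ { (tm d u v) → tm (c ℤ.* d) (x ℤ.+ u) (y ℤ.+ v) }) r }) p

infix 4 _≈ₚ_ _∣ₚ_
_≈ₚ_ : LPoly → LPoly → Set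
p ≈ₚ r = ∀ i j → coeff p i j ≡ coeff r i j

_∣ₚ_ : LPoly → LPoly → Set
d ∣ₚ p = Σ LPoly (λ r → d ⊗ r ≈ₚ p)

Coprime : LPoly → LPoly → Set
Coprime d p = ∀ c → c ∣ₚ d → c ∣ₚ p → c ∣ₚ one

record Frac : Set where
  constructor _//_
  field
    num : LPoly
    den : LPoly
open Frac public

infixl 6 _+F_
infixl 7 _*F_
_+F_ : Frac → Frac → Frac
(a // b) +F (c // d) = (a ⊗ d ⊕ c ⊗ b) // (b ⊗ d)

_*F_ : Frac → Frac → Frac
(a // b) *F (c // d) = (a ⊗ c) // (b ⊗ d)

-- F ≡ 0 modulo P : F = (P·N)/D for Laurent polynomials N, D with D
-- coprime to P.  (Equivalently: in reduced form, P divides the numerator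
-- and the denominator is coprime to P.)
CongZero : Frac → LPoly → Set
CongZero F P = Σ LPoly (λ N → Σ LPoly (λ D →
  Coprime D P × (num F ⊗ D ≈ₚ P ⊗ N ⊗ den F)))

qpow : ℤ → LPoly
qpow e = mon (+ 1) e (+ 0)

qbr : ℕ → ℤ → Frac
qbr e m = (one ⊖ qpow (+ e ℤ.* m)) // (one ⊖ qpow (+ e))

poch : ℤ → ℤ → ℕ → ℕ → LPoly
poch s t d zero    = one
poch s t d (suc k) = poch s t d k ⊗ (one ⊖ mon (+ 1) (s ℤ.+ + (d ℕ.* k)) t)

summand : ℕ → Frac
summand k =
  qbr 2 m *F qbr 1 m *F qbr 1 m *F
  ((poch (- + 2) (+ 0) 4 k ⊗ poch (- + 2) (+ 0) 4 k
     ⊗ poch (- + 2) (- + 1) 4 k ⊗ poch (- + 2) (+ 1) 4 k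
     ⊗ qpow (+ (4 ℕ.* k)))
   //
   (poch (+ 4) (+ 0) 4 k ⊗ poch (+ 4) (+ 0) 4 k
     ⊗ poch (+ 4) (- + 1) 4 k ⊗ poch (+ 4) (+ 1) 4 k))
  where
  m : ℤ
  m = + (4 ℕ.* k) ℤ.- + 1

sumTo : ℕ → Frac
sumTo zero    = summand 0
sumTo (suc M) = sumTo M +F summand (suc M)

qint2 : ℕ → LPoly
qint2 zero    = []
qint2 (suc n) = qint2 n ⊕ qpow (+ (2 ℕ.* n))

modulus : ℕ → LPoly
modulus n = qint2 n ⊗ qint2 n
  ⊗ (one ⊖ mon (+ 1) (+ (2 ℕ.* n)) (+ 1))
  ⊗ (mon (+ 1) (+ 0) (+ 1) ⊖ qpow (+ (2 ℕ.* n)))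

{-# OPTIONS --safe #-}
-- The sum is hypergeometrically summable: with X = q⁴ᴹ its partial sums are
--   Q(X) (q²;q⁴)_M² (q²/a;q⁴)_M (aq²;q⁴)_M / ((1-q)² q⁴ (1-aq²)(1-q²/a) (q⁴;q⁴)_M² (q⁴/a;q⁴)_M (aq⁴;q⁴)_M)
-- for a Laurent polynomial Q quadratic in X, which is checked by telescoping.  The factors (1-aq²ⁿ) and
-- (1-q²ⁿ/a) are visible in the numerator.  With x = q², (x;x²)_M/(x²;x²)_M is the central q-binomial
-- coefficient divided by (-x;x)_M², and [M]_x times this q-binomial coefficient is divisible by [n]_x when
-- n = 2M-1 or n = M+1.  Hence the sum times
--   D = (1-q)² ((-x;x)_M² [M]_x)² (q⁴/a;q⁴)_M (aq⁴;q⁴)_M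
-- is a multiple of the modulus P.
-- For the coprimality of D and P, the ideal (D , P) is shown to contain a nonzero polynomial in q alone and a
-- polynomial whose top coefficient in a is an integer times a power of q.  A common divisor of both is an
-- integer times a monomial, and it is a unit because P has leading coefficient ±1.
module Submission where

open import Defs
open import Level using (0ℓ)
open import Algebra.Bundles using (CommutativeRing)
import Algebra.Solver.Ring
open import Algebra.Solver.Ring.AlmostCommutativeRing using (fromCommutativeRing; _-Raw-AlmostCommutative⟶_)
open import Data.Empty using (⊥; ⊥-elim)
import Data.Fin as Fin
open import Data.Integer using (ℤ; +_; 0ℤ; 1ℤ)
import Data.Integer as I
import Data.Integer.Properties as I
import Data.Integer.Tactic.RingSolver as I
open import Data.List using ([]; _∷_; _++_; filter)
open import Data.List.Properties using (++-identityʳ; concatMap-++)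
open import Data.List.Relation.Unary.All using (All; []; _∷_; map)
open import Data.List.Relation.Unary.All.Properties using (all-filter)
open import Data.Maybe using (Maybe; just; nothing)
open import Data.Nat as ℕ using (ℕ; zero; suc)
import Data.Nat.DivMod as ℕ
import Data.Nat.Properties as ℕ
open import Data.Product using (∃; ∃₂; _×_; _,_; proj₁; proj₂)
open import Data.Sum using (_⊎_; inj₁; inj₂)
open import Function using (_∘_)
open import Relation.Binary.Definitions using (Trichotomous; Transitive; Tri; tri<; tri≈; tri>)
import Relation.Binary.PropositionalEquality as ≡
open import Relation.Nullary using (Dec; yes; no; ¬_)

-- Identities in commutative rings

-- No cyclotomic factorisation is used: the factor [n]_x is produced whole, by two evaluations of
-- one product, (1-x^M) binom(2M,M) = (1-x^(2M-1)) (1+x^M) binom(2M-2,M-1) = (1-x^(M+1))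
-- binom(2M,M-1). They explain the [M]_x in D and the two admissible M. This [M]_x does no harm,
-- since in both cases it is comaximal with [n]_x. The other factors of D need more care because the
-- coefficients are integers: modulo 1-q the polynomial [n]_x becomes n, so the ideal they generate
-- is proper although they have no common factor. The ideals therefore only show a common divisor to
-- be an integer times a monomial, and the integer has to be excluded separately. Division is
-- avoided throughout. The identities live in an arbitrary commutative ring with chosen inverses of
-- q and a, fractions are compared by cross multiplication, and only elements proved regular are
-- cancelled.

module QSeries (R : CommutativeRing 0ℓ 0ℓ)
               (φ : I.+-*-rawRing -Raw-AlmostCommutative⟶ fromCommutativeRing R) where
  open CommutativeRing R
  open _-Raw-AlmostCommutative⟶_ φ using (⟦_⟧; +-homo; 0-homo; 1-homo)
  open import Algebra.Properties.Semiring.Exp semiring using (_^_; ^-homo-*; ^-assocʳ; ^-congˡ)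
  open import Algebra.Properties.CommutativeSemiring.Exp commutativeSemiring using (^-distrib-*)
  open import Algebra.Properties.Group +-group using (x∙y⁻¹≈ε⇒x≈y)
  open import Relation.Binary.Reasoning.Setoid setoid

  private
    _coeff≟_ : ∀ m n → Maybe (⟦ m ⟧ ≈ ⟦ n ⟧)
    m coeff≟ n with m I.≟ n
    ... | yes ≡.refl = just refl
    ... | no _       = nothing

    module S = Algebra.Solver.Ring I.+-*-rawRing (fromCommutativeRing R) φ _coeff≟_
    open S using (solve; _:=_; _:+_; _:*_; _:-_; _:^_)

    -- con 1ℤ denotes ⟦ 1ℤ ⟧, whereas a zeroth power denotes 1# on the nose.
    :1 : ∀ {n} → S.Polynomial (suc n)
    :1 = S.var Fin.zero :^ 0

  -- Regularity of single elements replaces an integral-domain hypothesis on the ring. For Laurent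
  -- polynomials it is read off a leading term.
  Regular : Carrier → Set
  Regular u = ∀ y → u * y ≈ 0# → y ≈ 0#

  Regular-* : ∀ {u v} → Regular u → Regular v → Regular (u * v)
  Regular-* {u} {v} ru rv y uvy≈0 = rv y (ru (v * y) (trans (sym (*-assoc u v y)) uvy≈0))

  Regular-resp : ∀ {u v} → u ≈ v → Regular u → Regular v
  Regular-resp u≈v ru y vy≈0 = ru y (trans (*-congʳ u≈v) vy≈0)

  cancel : ∀ {u} → Regular u → ∀ y z → u * y ≈ u * z → y ≈ z
  cancel {u} ru y z uy≈uz = x∙y⁻¹≈ε⇒x≈y y z (ru (y - z) (begin
    u * (y - z)      ≈⟨ solve 3 (λ u y z → u :* (y :- z) := u :* y :- u :* z) refl u y z ⟩
    u * y - u * z    ≈⟨ +-congʳ uy≈uz ⟩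
    u * z - u * z    ≈⟨ -‿inverseʳ (u * z) ⟩
    0#               ∎))

  ∏ : (ℕ → Carrier) → ℕ → Carrier
  ∏ f zero    = 1#
  ∏ f (suc k) = ∏ f k * f k

  ∏-cong : ∀ {f g} → (∀ j → f j ≈ g j) → ∀ k → ∏ f k ≈ ∏ g k
  ∏-cong f≈g zero    = refl
  ∏-cong f≈g (suc k) = *-cong (∏-cong f≈g k) (f≈g k)

  Regular-1 : Regular 1#
  Regular-1 y 1y≈0 = trans (sym (*-identityˡ y)) 1y≈0

  Regular-∏ : ∀ {f} → (∀ j → Regular (f j)) → ∀ k → Regular (∏ f k)
  Regular-∏ rf zero    = Regular-1
  Regular-∏ rf (suc k) = Regular-* (Regular-∏ rf k) (rf k)

  -- (u ; p)ₖ
  qPoch : Carrier → Carrier → ℕ → Carrier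
  qPoch u p = ∏ (λ j → 1# - u * p ^ j)

  1-cong : ∀ {u v} → u ≈ v → 1# - u ≈ 1# - v
  1-cong u≈v = +-congˡ (-‿cong u≈v)

  qPoch-cong : ∀ {u v p r} → u ≈ v → p ≈ r → ∀ k → qPoch u p k ≈ qPoch v r k
  qPoch-cong u≈v p≈r = ∏-cong (λ j → 1-cong (*-cong u≈v (^-congˡ j p≈r)))

  qPoch-shift : ∀ u p k → qPoch u p (suc k) ≈ (1# - u) * qPoch (u * p) p k
  qPoch-shift u p zero    = solve 1 (λ u → :1 :* (:1 :- u :* :1) := (:1 :- u) :* :1) refl u
  qPoch-shift u p (suc k) = begin
    qPoch u p (suc k) * (1# - u * (p * p ^ k))
      ≈⟨ *-congʳ (qPoch-shift u p k) ⟩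
    (1# - u) * qPoch (u * p) p k * (1# - u * (p * p ^ k))
      ≈⟨ solve 4 (λ u p Y Z → (:1 :- u) :* Z :* (:1 :- u :* (p :* Y)) := (:1 :- u) :* (Z :* (:1 :- u :* p :* Y)))
               refl u p (p ^ k) (qPoch (u * p) p k) ⟩
    (1# - u) * (qPoch (u * p) p k * (1# - u * p * p ^ k)) ∎

  qPoch-factor : ∀ u p {i k} → i ℕ.< k → ∃ λ r → qPoch u p k ≈ (1# - u * p ^ i) * r
  qPoch-factor u p {i} {suc k} i<1+k with i ℕ.≟ k
  ... | yes ≡.refl = qPoch u p k , *-comm _ _
  ... | no i≢k with qPoch-factor u p {i} {k} (ℕ.≤∧≢⇒< (ℕ.≤-pred i<1+k) i≢k)
  ...   | r , eq = r * (1# - u * p ^ k) , trans (*-congʳ eq) (*-assoc _ _ _)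

  geom : Carrier → ℕ → Carrier
  geom y zero    = 0#
  geom y (suc n) = geom y n + y ^ n

  geom-sum : ∀ y n → (1# - y) * geom y n ≈ 1# - y ^ n
  geom-sum y zero    = trans (zeroʳ _) (sym (-‿inverseʳ 1#))
  geom-sum y (suc n) = begin
    (1# - y) * (geom y n + y ^ n)
      ≈⟨ distribˡ _ _ _ ⟩
    (1# - y) * geom y n + (1# - y) * y ^ n
      ≈⟨ +-congʳ (geom-sum y n) ⟩
    (1# - y ^ n) + (1# - y) * y ^ n
      ≈⟨ solve 2 (λ y Y → (:1 :- Y) :+ (:1 :- y) :* Y := :1 :- y :* Y) refl y (y ^ n) ⟩
    1# - y * y ^ n ∎

  geom-suc : ∀ y n → geom y (suc n) ≈ 1# + y * geom y n
  geom-suc y zero    = trans (+-identityˡ 1#) (sym (trans (+-congˡ (zeroʳ y)) (+-identityʳ 1#)))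
  geom-suc y (suc n) = begin
    geom y (suc n) + y ^ suc n           ≈⟨ +-congʳ (geom-suc y n) ⟩
    (1# + y * geom y n) + y * y ^ n      ≈⟨ solve 3 (λ y g Y → (:1 :+ y :* g) :+ y :* Y := :1 :+ y :* (g :+ Y)) refl y (geom y n) (y ^ n) ⟩
    1# + y * (geom y n + y ^ n)          ∎

  geom-double : ∀ y n → geom y (n ℕ.+ n) ≈ geom y n * (1# + y ^ n)
  geom-double y n = trans (go n) (solve 2 (λ g Y → g :+ Y :* g := g :* (:1 :+ Y)) refl (geom y n) (y ^ n))
    where
    go : ∀ k → geom y (k ℕ.+ n) ≈ geom y n + y ^ n * geom y k
    go zero    = sym (trans (+-congˡ (zeroʳ _)) (+-identityʳ _))
    go (suc k) = begin
      geom y (k ℕ.+ n) + y ^ (k ℕ.+ n)              ≈⟨ +-cong (go k) (^-homo-* y k n) ⟩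
      geom y n + y ^ n * geom y k + y ^ k * y ^ n
        ≈⟨ solve 4 (λ g Y h Z → g :+ Y :* h :+ Z :* Y := g :+ Y :* (h :+ Z)) refl (geom y n) (y ^ n) (geom y k) (y ^ k) ⟩
      geom y n + y ^ n * (geom y k + y ^ k)         ∎

  -- Gaussian binomial coefficients

  module Binomial (x : Carrier) (regular : ∀ j → Regular (1# - x ^ suc j)) where

    qFactorial oddPart evenPart signedPart : ℕ → Carrier
    qFactorial = ∏ (λ j → 1# - x ^ suc j)
    oddPart    = qPoch x (x * x)
    evenPart   = qPoch (x * x) (x * x)
    signedPart = ∏ (λ j → 1# + x ^ suc j)

    -- The Gaussian binomial coefficient of m + k over k. Pascal's rule in the two arguments m and k
    -- defines it without division.
    qBinomial : ℕ → ℕ → Carrier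
    qBinomial zero    k       = 1#
    qBinomial (suc m) zero    = 1#
    qBinomial (suc m) (suc k) = qBinomial m (suc k) + x ^ suc m * qBinomial (suc m) k

    -- The two terms of Pascal's rule combine through (1-X) + X(1-Y) = 1-XY with X = x^(m+1) and Y =
    -- x^(k+1).
    qBinomial-factorial : ∀ m k → qFactorial m * qFactorial k * qBinomial m k ≈ qFactorial (m ℕ.+ k)
    qBinomial-factorial zero    k       = trans (*-identityʳ _) (*-identityˡ _)
    qBinomial-factorial (suc m) zero    rewrite ℕ.+-identityʳ m = trans (*-identityʳ _) (*-identityʳ _)
    qBinomial-factorial (suc m) (suc k) = begin
      fm * (1# - X) * (fk * (1# - Y)) * (qBinomial m (suc k) + X * qBinomial (suc m) k)
        ≈⟨ solve 6 (λ fm fk X Y b c → fm :* (:1 :- X) :* (fk :* (:1 :- Y)) :* (b :+ X :* c) :=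
                       (:1 :- X) :* (fm :* (fk :* (:1 :- Y)) :* b) :+ X :* (:1 :- Y) :* (fm :* (:1 :- X) :* fk :* c))
                 refl fm fk X Y (qBinomial m (suc k)) (qBinomial (suc m) k) ⟩
      (1# - X) * (qFactorial m * qFactorial (suc k) * qBinomial m (suc k))
        + X * (1# - Y) * (qFactorial (suc m) * qFactorial k * qBinomial (suc m) k)
        ≈⟨ +-cong (*-congˡ (qBinomial-factorial m (suc k))) (*-congˡ (qBinomial-factorial (suc m) k)) ⟩
      (1# - X) * qFactorial (m ℕ.+ suc k) + X * (1# - Y) * qFactorial (suc m ℕ.+ k)
        ≈⟨ +-congˡ (*-congˡ (reflexive (≡.cong qFactorial (≡.sym (ℕ.+-suc m k))))) ⟩
      (1# - X) * qFactorial (m ℕ.+ suc k) + X * (1# - Y) * qFactorial (m ℕ.+ suc k)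
        ≈⟨ solve 3 (λ X Y F → (:1 :- X) :* F :+ X :* (:1 :- Y) :* F := F :* (:1 :- X :* Y)) refl X Y (qFactorial (m ℕ.+ suc k)) ⟩
      qFactorial (m ℕ.+ suc k) * (1# - X * Y)
        ≈⟨ *-congˡ (1-cong (^-homo-* x (suc m) (suc k))) ⟨
      qFactorial (m ℕ.+ suc k) * (1# - x ^ (suc m ℕ.+ suc k)) ∎
      where
      fm = qFactorial m
      fk = qFactorial k
      X  = x ^ suc m
      Y  = x ^ suc k

    square-^ : ∀ k → (x * x) ^ k ≈ x ^ k * x ^ k
    square-^ k = ^-distrib-* x x k

    qFactorial-double : ∀ k → qFactorial (suc k ℕ.+ suc k)
      ≈ qFactorial (k ℕ.+ k) * (1# - x * (x ^ k * x ^ k)) * (1# - x ^ suc k * x ^ suc k)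
    qFactorial-double k = begin
      qFactorial (suc k ℕ.+ suc k)
        ≈⟨ reflexive (≡.cong (λ z → qFactorial (suc z)) (ℕ.+-suc k k)) ⟩
      qFactorial (k ℕ.+ k) * (1# - x * x ^ (k ℕ.+ k)) * (1# - x * (x * x ^ (k ℕ.+ k)))
        ≈⟨ *-cong (*-congˡ (1-cong (*-congˡ (^-homo-* x k k))))
                  (1-cong (trans (*-congˡ (*-congˡ (^-homo-* x k k)))
                                 (solve 2 (λ x X → x :* (x :* (X :* X)) := x :* X :* (x :* X)) refl x (x ^ k)))) ⟩
      qFactorial (k ℕ.+ k) * (1# - x * (x ^ k * x ^ k)) * (1# - x ^ suc k * x ^ suc k) ∎

    -- The factors 1-x^j of (x;x)_2k are sorted by the parity of j.
    odd-even : ∀ k → oddPart k * evenPart k ≈ qFactorial (k ℕ.+ k)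
    odd-even zero    = *-identityʳ 1#
    odd-even (suc k) = begin
      oddPart k * (1# - x * (x * x) ^ k) * (evenPart k * (1# - x * x * (x * x) ^ k))
        ≈⟨ *-cong (*-congˡ (1-cong (*-congˡ (square-^ k)))) (*-congˡ (1-cong (*-congˡ (square-^ k)))) ⟩
      oddPart k * (1# - x * (x ^ k * x ^ k)) * (evenPart k * (1# - x * x * (x ^ k * x ^ k)))
        ≈⟨ solve 4 (λ x X o e → o :* (:1 :- x :* (X :* X)) :* (e :* (:1 :- x :* x :* (X :* X)))
                             := o :* e :* (:1 :- x :* (X :* X)) :* (:1 :- x :* X :* (x :* X))) refl x (x ^ k) (oddPart k) (evenPart k) ⟩
      oddPart k * evenPart k * (1# - x * (x ^ k * x ^ k)) * (1# - x ^ suc k * x ^ suc k)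
        ≈⟨ *-congʳ (*-congʳ (odd-even k)) ⟩
      qFactorial (k ℕ.+ k) * (1# - x * (x ^ k * x ^ k)) * (1# - x ^ suc k * x ^ suc k)
        ≈⟨ qFactorial-double k ⟨
      qFactorial (suc k ℕ.+ suc k) ∎

    even-factor : ∀ k → evenPart k ≈ qFactorial k * signedPart k
    even-factor zero    = sym (*-identityʳ 1#)
    even-factor (suc k) = begin
      evenPart k * (1# - x * x * (x * x) ^ k)
        ≈⟨ *-cong (even-factor k) (1-cong (*-congˡ (square-^ k))) ⟩
      qFactorial k * signedPart k * (1# - x * x * (x ^ k * x ^ k))
        ≈⟨ solve 4 (λ x X f s → f :* s :* (:1 :- x :* x :* (X :* X)) := f :* (:1 :- x :* X) :* (s :* (:1 :+ x :* X)))
                 refl x (x ^ k) (qFactorial k) (signedPart k) ⟩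
      qFactorial (suc k) * signedPart (suc k) ∎

    Regular-factorial : ∀ k → Regular (qFactorial k)
    Regular-factorial = Regular-∏ regular

    odd-signed : ∀ k → oddPart k * signedPart k ≈ qFactorial k * qBinomial k k
    odd-signed k = cancel (Regular-factorial k) _ _ (begin
      qFactorial k * (oddPart k * signedPart k)
        ≈⟨ solve 3 (λ f o s → f :* (o :* s) := o :* (f :* s)) refl (qFactorial k) (oddPart k) (signedPart k) ⟩
      oddPart k * (qFactorial k * signedPart k)       ≈⟨ *-congˡ (even-factor k) ⟨
      oddPart k * evenPart k                          ≈⟨ odd-even k ⟩
      qFactorial (k ℕ.+ k)                            ≈⟨ qBinomial-factorial k k ⟨
      qFactorial k * qFactorial k * qBinomial k k     ≈⟨ *-assoc _ _ _ ⟩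
      qFactorial k * (qFactorial k * qBinomial k k)   ∎)

    -- The quotient of `oddPart` by `evenPart` thus has no denominator except (-x;x)_k squared,
    -- whose factors 1+x^j divide 2 modulo [n]_x for odd n.
    odd-signed² : ∀ k → oddPart k * (signedPart k * signedPart k) ≈ evenPart k * qBinomial k k
    odd-signed² k = begin
      oddPart k * (signedPart k * signedPart k)          ≈⟨ *-assoc _ _ _ ⟨
      oddPart k * signedPart k * signedPart k            ≈⟨ *-congʳ (odd-signed k) ⟩
      qFactorial k * qBinomial k k * signedPart k
        ≈⟨ solve 3 (λ f b s → f :* b :* s := f :* s :* b) refl (qFactorial k) (qBinomial k k) (signedPart k) ⟩
      qFactorial k * signedPart k * qBinomial k k        ≈⟨ *-congʳ (even-factor k) ⟨
      evenPart k * qBinomial k k                         ∎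

    -- Multiplied by (x;x)_(k+1) (x;x)_k, both sides become (x;x)_(2k+2). With M = k+1 this serves
    -- the case n = M+1.
    central-shift : ∀ k → (1# - x ^ suc k) * qBinomial (suc k) (suc k)
                        ≈ (1# - x ^ suc (suc k)) * qBinomial (suc (suc k)) k
    central-shift k = cancel (Regular-* (Regular-factorial (suc k)) (Regular-factorial k)) _ _ (begin
      f′ * f * ((1# - x ^ suc k) * b)
        ≈⟨ solve 4 (λ g f X b → g :* f :* ((:1 :- X) :* b) := g :* (f :* (:1 :- X)) :* b) refl f′ f (x ^ suc k) b ⟩
      f′ * f′ * b                            ≈⟨ qBinomial-factorial (suc k) (suc k) ⟩
      qFactorial (suc k ℕ.+ suc k)           ≈⟨ reflexive (≡.cong (λ z → qFactorial (suc z)) (ℕ.+-suc k k)) ⟩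
      qFactorial (suc (suc k) ℕ.+ k)         ≈⟨ qBinomial-factorial (suc (suc k)) k ⟨
      qFactorial (suc (suc k)) * f * c
        ≈⟨ solve 4 (λ g f X c → g :* (:1 :- X) :* f :* c := g :* f :* ((:1 :- X) :* c)) refl f′ f (x ^ suc (suc k)) c ⟩
      f′ * f * ((1# - x ^ suc (suc k)) * c)  ∎)
      where
      f  = qFactorial k
      f′ = qFactorial (suc k)
      b  = qBinomial (suc k) (suc k)
      c  = qBinomial (suc (suc k)) k

    -- The quotient of consecutive central coefficients, in which 1-x^(2k+2) contributes one factor
    -- 1-x^(k+1) that cancels. With M = k+1 this serves the case n = 2M-1.
    central-step : ∀ k → (1# - x ^ suc k) * qBinomial (suc k) (suc k)
                       ≈ (1# - x ^ (suc (k ℕ.+ k))) * ((1# + x ^ suc k) * qBinomial k k)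
    central-step k = cancel (Regular-* (Regular-* (Regular-factorial k) (Regular-factorial k)) (regular k)) _ _ (begin
      f * f * (1# - X) * ((1# - X) * b)
        ≈⟨ solve 3 (λ f X b → f :* f :* (:1 :- X) :* ((:1 :- X) :* b) := f :* (:1 :- X) :* (f :* (:1 :- X)) :* b) refl f X b ⟩
      f * (1# - X) * (f * (1# - X)) * b      ≈⟨ qBinomial-factorial (suc k) (suc k) ⟩
      qFactorial (suc k ℕ.+ suc k)           ≈⟨ qFactorial-double k ⟩
      qFactorial (k ℕ.+ k) * (1# - x * (x ^ k * x ^ k)) * (1# - X * X)
        ≈⟨ *-congʳ (*-cong (qBinomial-factorial k k) (1-cong (*-congˡ (^-homo-* x k k)))) ⟨
      f * f * c * (1# - Y) * (1# - X * X)
        ≈⟨ solve 4 (λ f c X Y → f :* f :* c :* (:1 :- Y) :* (:1 :- X :* X) := f :* f :* (:1 :- X) :* ((:1 :- Y) :* ((:1 :+ X) :* c)))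
                 refl f c X Y ⟩
      f * f * (1# - X) * ((1# - Y) * ((1# + X) * c)) ∎)
      where
      f = qFactorial k
      b = qBinomial (suc k) (suc k)
      c = qBinomial k k
      X = x ^ suc k
      Y = x ^ suc (k ℕ.+ k)

    Regular-1-x : Regular (1# - x)
    Regular-1-x = Regular-resp (1-cong (*-identityʳ x)) (regular 0)

    -- The modulus contains [n]_x and not 1-x^n, so a factor 1-x is cancelled. Leaving `n` and `c`
    -- open lets both choices of M share everything that follows.
    geom-central : ∀ k n c → (1# - x ^ suc k) * qBinomial (suc k) (suc k) ≈ (1# - x ^ n) * c →
      geom x (suc k) * qBinomial (suc k) (suc k) ≈ geom x n * c
    geom-central k n c eq = cancel Regular-1-x _ _ (begin
      (1# - x) * (geom x (suc k) * b)   ≈⟨ *-assoc _ _ _ ⟨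
      (1# - x) * geom x (suc k) * b     ≈⟨ *-congʳ (geom-sum x (suc k)) ⟩
      (1# - x ^ suc k) * b              ≈⟨ eq ⟩
      (1# - x ^ n) * c                  ≈⟨ *-congʳ (geom-sum x n) ⟨
      (1# - x) * geom x n * c           ≈⟨ *-assoc _ _ _ ⟩
      (1# - x) * (geom x n * c)         ∎)
      where b = qBinomial (suc k) (suc k)

    clearing : ℕ → Carrier
    clearing k = signedPart k * signedPart k * geom x k

    odd-clearing : ∀ k n c → (1# - x ^ suc k) * qBinomial (suc k) (suc k) ≈ (1# - x ^ n) * c →
      oddPart (suc k) * clearing (suc k) ≈ geom x n * c * evenPart (suc k)
    odd-clearing k n c eq = begin
      oddPart M * (signedPart M * signedPart M * geom x M)     ≈⟨ *-assoc _ _ _ ⟨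
      oddPart M * (signedPart M * signedPart M) * geom x M     ≈⟨ *-congʳ (odd-signed² M) ⟩
      evenPart M * qBinomial M M * geom x M
        ≈⟨ solve 3 (λ e b g → e :* b :* g := g :* b :* e) refl (evenPart M) (qBinomial M M) (geom x M) ⟩
      geom x M * qBinomial M M * evenPart M                    ≈⟨ *-congʳ (geom-central k n c eq) ⟩
      geom x n * c * evenPart M                                ∎
      where M = suc k

  -- Ideals with two generators and their explicit members

  infix 4 _∈⟨_,_⟩
  _∈⟨_,_⟩ : Carrier → Carrier → Carrier → Set
  f ∈⟨ d , p ⟩ = ∃₂ λ u v → u * d + v * p ≈ f

  ∈-generator : ∀ {d p} → d ∈⟨ d , p ⟩
  ∈-generator {d} {p} = 1# , 0# , trans (+-cong (*-identityˡ d) (zeroˡ p)) (+-identityʳ d)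

  -- When the two combinations are multiplied out, every term except the multiple of d e carries a
  -- factor p.
  ∈-* : ∀ {f g d e p} → f ∈⟨ d , p ⟩ → g ∈⟨ e , p ⟩ → f * g ∈⟨ d * e , p ⟩
  ∈-* {f} {g} {d} {e} {p} (u , v , ud+vp≈f) (u′ , v′ , ue+vp≈g) =
    u * u′ , u * d * v′ + v * u′ * e + v * v′ * p ,
    trans (solve 7 (λ u v u′ v′ d e p → u :* u′ :* (d :* e) :+ (u :* d :* v′ :+ v :* u′ :* e :+ v :* v′ :* p) :* p
                                     := (u :* d :+ v :* p) :* (u′ :* e :+ v′ :* p)) refl u v u′ v′ d e p)
          (*-cong ud+vp≈f ue+vp≈g)

  -- Modulo d, f is v p, so its square is a multiple of p squared. A relation with [n]_x alone
  -- thereby yields one with the full modulus, while d stays to the first power.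
  ∈-square : ∀ {f d p} s t → f ∈⟨ d , p ⟩ → f * f * s * t ∈⟨ d , p * p * s * t ⟩
  ∈-square {f} {d} {p} s t (u , v , eq) =
    (u * u * d + (u * v + u * v) * p) * s * t , v * v ,
    trans (solve 6 (λ u v d p s t → (u :* u :* d :+ (u :* v :+ u :* v) :* p) :* s :* t :* d :+ v :* v :* (p :* p :* s :* t)
                                 := (u :* d :+ v :* p) :* (u :* d :+ v :* p) :* s :* t) refl u v d p s t)
          (*-congʳ (*-congʳ (*-cong eq eq)))

  -- Modulo d the element a equals y, so the modulus may be evaluated at a = y. The coefficient of d
  -- is the exact quotient of the resulting difference.
  ∈-substitute : ∀ {a y e d} z t → a ≈ y + e * d →
    t * (1# - y * z) * (y - z) ∈⟨ d , t * (1# - a * z) * (a - z) ⟩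
  ∈-substitute {a} {y} {e} {d} z t a≈ =
    t * (e * z * (y - z) - (1# - y * z) * e + e * e * d * z) , 1# ,
    trans (+-congˡ (*-congˡ (*-cong (*-congˡ (1-cong (*-congʳ a≈))) (+-congʳ a≈))))
          (solve 5 (λ y e d z t → t :* (e :* z :* (y :- z) :- (:1 :- y :* z) :* e :+ e :* e :* d :* z) :* d
                                    :+ :1 :* (t :* (:1 :- (y :+ e :* d) :* z) :* (y :+ e :* d :- z))
                               := t :* (:1 :- y :* z) :* (y :- z)) refl y e d z t)

  -- At q = 1 each of the n terms of the geometric sum is 1.
  geom-mod-1-q : ∀ q n → ⟦ + n ⟧ ∈⟨ 1# - q , geom (q ^ 2) n ⟩
  geom-mod-1-q q n = w n , 1# , trans (+-congˡ (*-identityˡ _)) (eq n)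
    where
    w : ℕ → Carrier
    w zero    = 0#
    -- The quotient of n - [n]_x by 1-q grows by (1-x^n)/(1-q) = (1+q) [n]_x, where x = q^2.
    w (suc n) = w n + (1# + q) * geom (q ^ 2) n
    eq : ∀ n → w n * (1# - q) + geom (q ^ 2) n ≈ ⟦ + n ⟧
    eq zero    = trans (+-identityʳ _) (trans (zeroˡ _) (sym 0-homo))
    eq (suc n) = begin
      (w n + (1# + q) * g) * (1# - q) + (g + (q ^ 2) ^ n)
        ≈⟨ solve 4 (λ q w g X → (w :+ (:1 :+ q) :* g) :* (:1 :- q) :+ (g :+ X) := (w :* (:1 :- q) :+ g) :+ ((:1 :- q :^ 2) :* g :+ X))
                 refl q (w n) g ((q ^ 2) ^ n) ⟩
      (w n * (1# - q) + g) + ((1# - q ^ 2) * g + (q ^ 2) ^ n)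
        ≈⟨ +-cong (eq n) (+-congʳ (geom-sum (q ^ 2) n)) ⟩
      ⟦ + n ⟧ + ((1# - (q ^ 2) ^ n) + (q ^ 2) ^ n)
        ≈⟨ +-congˡ (solve 1 (λ X → :1 :- X :+ X := :1) refl ((q ^ 2) ^ n)) ⟩
      ⟦ + n ⟧ + 1#             ≈⟨ +-comm _ _ ⟩
      1# + ⟦ + n ⟧             ≈⟨ +-congʳ 1-homo ⟨
      ⟦ + 1 ⟧ + ⟦ + n ⟧        ≈⟨ +-homo (+ 1) (+ n) ⟨
      ⟦ + suc n ⟧ ∎
      where g = geom (q ^ 2) n

  1+y∣1+y^odd : ∀ y m → ∃ λ h → h * (1# + y) ≈ 1# + y ^ suc (m ℕ.+ m)
  1+y∣1+y^odd y zero    = 1# , solve 1 (λ y → :1 :* (:1 :+ y) := :1 :+ y :* :1) refl y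
  1+y∣1+y^odd y (suc m) with 1+y∣1+y^odd y m
  -- The new quotient comes from 1 + y^(n+2) = (1-y^2) + y^2 (1+y^n) with n odd.
  ... | h , eq = (1# - y) + y * y * h , (begin
    ((1# - y) + y * y * h) * (1# + y)
      ≈⟨ solve 2 (λ y h → ((:1 :- y) :+ y :* y :* h) :* (:1 :+ y) := (:1 :- y :* y) :+ y :* y :* (h :* (:1 :+ y))) refl y h ⟩
    (1# - y * y) + y * y * (h * (1# + y))
      ≈⟨ +-congˡ (*-congˡ eq) ⟩
    (1# - y * y) + y * y * (1# + y ^ suc (m ℕ.+ m))
      ≈⟨ solve 2 (λ y Y → (:1 :- y :* y) :+ y :* y :* (:1 :+ Y) := :1 :+ y :* (y :* Y)) refl y (y ^ suc (m ℕ.+ m)) ⟩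
    1# + y ^ suc (suc (suc (m ℕ.+ m)))
      ≈⟨ reflexive (≡.cong (λ z → 1# + y ^ suc (suc z)) (≡.sym (ℕ.+-suc m m))) ⟩
    1# + y ^ suc (suc m ℕ.+ suc m) ∎)

  -- Modulo 1 + xʲ the power (xʲ)ⁿ is -1 since n is odd, and modulo 1 - xⁿ it is 1.
  geom-mod-1+ : ∀ x j m → ⟦ + 2 ⟧ ∈⟨ 1# + x ^ j , geom x (suc (m ℕ.+ m)) ⟩
  geom-mod-1+ x j m with 1+y∣1+y^odd (x ^ j) m
  ... | h , eq = h , geom (x ^ n) j * (1# - x) , (begin
    h * (1# + x ^ j) + geom (x ^ n) j * (1# - x) * geom x n
      ≈⟨ +-cong eq (trans (*-assoc _ _ _) (*-congˡ (geom-sum x n))) ⟩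
    (1# + (x ^ j) ^ n) + geom (x ^ n) j * (1# - x ^ n)
      ≈⟨ +-congˡ (trans (*-comm _ _) (geom-sum (x ^ n) j)) ⟩
    (1# + (x ^ j) ^ n) + (1# - (x ^ n) ^ j)
      ≈⟨ +-congˡ (1-cong (trans (^-assocʳ x n j) (trans (reflexive (≡.cong (x ^_) (ℕ.*-comm n j))) (sym (^-assocʳ x j n))))) ⟩
    (1# + (x ^ j) ^ n) + (1# - (x ^ j) ^ n)
      ≈⟨ solve 1 (λ Y → (:1 :+ Y) :+ (:1 :- Y) := :1 :+ :1) refl ((x ^ j) ^ n) ⟩
    1# + 1#            ≈⟨ +-cong 1-homo 1-homo ⟨
    ⟦ + 1 ⟧ + ⟦ + 1 ⟧  ≈⟨ +-homo (+ 1) (+ 1) ⟨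
    ⟦ + 2 ⟧            ∎)
    where n = suc (m ℕ.+ m)

  -- One Euclidean step: [k+1] - x [k] = 1. It handles [M]_x for n = M+1.
  geom-comaximal-suc : ∀ x k → 1# ∈⟨ geom x k , geom x (suc k) ⟩
  geom-comaximal-suc x k = - x , 1# , (begin
    - x * geom x k + 1# * geom x (suc k)         ≈⟨ +-congˡ (*-congˡ (geom-suc x k)) ⟩
    - x * geom x k + 1# * (1# + x * geom x k)    ≈⟨ solve 2 (λ x g → S.:- x :* g :+ :1 :* (:1 :+ x :* g) := :1) refl x (geom x k) ⟩
    1#                                           ∎)

  -- [k+1] (1+x^(k+1)) = [2k+2] = 1 + x [2k+1]. It handles [M]_x for n = 2M-1.
  geom-comaximal-half : ∀ x k → 1# ∈⟨ geom x (suc k) , geom x (suc (k ℕ.+ k)) ⟩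
  geom-comaximal-half x k = 1# + x ^ suc k , - x , (begin
    (1# + x ^ suc k) * geom x (suc k) + - x * g         ≈⟨ +-congʳ (trans (*-comm _ _) (sym (geom-double x (suc k)))) ⟩
    geom x (suc k ℕ.+ suc k) + - x * g                  ≈⟨ +-congʳ (reflexive (≡.cong (λ z → geom x (suc z)) (ℕ.+-suc k k))) ⟩
    geom x (suc (suc (k ℕ.+ k))) + - x * g              ≈⟨ +-congʳ (geom-suc x (suc (k ℕ.+ k))) ⟩
    (1# + x * g) + - x * g                              ≈⟨ solve 2 (λ x g → (:1 :+ x :* g) :+ S.:- x :* g := :1) refl x g ⟩
    1#                                                  ∎)
    where g = geom x (suc (k ℕ.+ k))

  -- Telescoping, with t and b as the inverses of q and a

  module Telescoping (q t a b : Carrier) (tq≈1 : t * q ≈ 1#) (ab≈1 : a * b ≈ 1#) where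

    s p x r : Carrier
    s = a + b
    p = q ^ 4
    x = q ^ 2
    r = t ^ 2

    private
      w C B : Carrier
      w = 1# - q + q * q
      C = q * (w + w - q * s)
      B = q * q * ((1# - q) * (1# - q) + (w + w) * s) - (1# + q * q * q) * (1# + q * q * q)

    -- Found by interpolating the partial sums: they are hypergeometric up to this quadratic in X = q⁴ᵏ.
    Q : Carrier → Carrier
    Q X = C * (1# + (q * X) * (q * X)) + B * X

    -- The four Pochhammer symbols always occur together: u = r = q^(-2) gives the numerator of a
    -- summand, u = p = q^4 its denominator, and u = x = q^2 the numerator of the closed form.
    pochs : Carrier → ℕ → Carrier
    pochs u k = qPoch u p k * qPoch u p k * qPoch (u * b) p k * qPoch (u * a) p k

    -- The indices differ: `summandNum k` belongs to the summand k+1, where 4(k+1)-1 = 4k+3 is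
    -- positive, whereas `summandDen k` belongs to the summand k. The summand 0, with its q-integers
    -- of -1, has the numerator `summandNum₀`.
    closedNum closedDen summandNum summandDen : ℕ → Carrier
    closedNum k  = Q (p ^ k) * pochs x k
    closedDen k  = (1# - q) * (1# - q) * p * ((1# - x * b) * (1# - x * a)) * pochs p k
    summandNum k = (1# - q ^ 6 * (p ^ k * p ^ k)) * (1# - q ^ 3 * p ^ k) * (1# - q ^ 3 * p ^ k) * (pochs r (suc k) * p ^ suc k)
    summandDen k = (1# - x) * (1# - q) * (1# - q) * pochs p k

    -- The factor 1-pY/a vanishes at a = pY; likewise 1-paY in `a-mod-1-paY` vanishes at the inverse
    -- of pY. These are the values put into `∈-substitute`.
    a-mod-1-pbY : ∀ Y → a ≈ p * Y + a * (1# - p * b * Y)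
    a-mod-1-pbY Y = sym (begin
      p * Y + a * (1# - p * b * Y)
        ≈⟨ solve 4 (λ a b p Y → p :* Y :+ a :* (:1 :- p :* b :* Y) := a :+ (p :* Y :- a :* b :* (p :* Y))) refl a b p Y ⟩
      a + (p * Y - a * b * (p * Y))        ≈⟨ +-congˡ (+-congˡ (-‿cong (*-congʳ ab≈1))) ⟩
      a + (p * Y - 1# * (p * Y))           ≈⟨ solve 2 (λ a Z → a :+ (Z :- :1 :* Z) := a) refl a (p * Y) ⟩
      a                                    ∎)

    a-mod-1-paY : ∀ Y y → y * (p * Y) ≈ 1# → a ≈ y + - y * (1# - p * a * Y)
    a-mod-1-paY Y y ypY≈1 = sym (begin
      y + - y * (1# - p * a * Y)           ≈⟨ solve 4 (λ a p Y y → y :+ S.:- y :* (:1 :- p :* a :* Y) := y :* (p :* Y) :* a) refl a p Y y ⟩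
      y * (p * Y) * a                      ≈⟨ *-congʳ ypY≈1 ⟩
      1# * a                               ≈⟨ *-identityˡ a ⟩
      a                                    ∎)

    Regular-closedDen : Regular (1# - q) → Regular p → (∀ j → Regular (1# - p * p ^ j)) →
      Regular (1# - x * b) → Regular (1# - x * a) →
      (∀ j → Regular (1# - p * b * p ^ j)) → (∀ j → Regular (1# - p * a * p ^ j)) → ∀ k → Regular (closedDen k)
    Regular-closedDen 1-q p 1-p 1-xb 1-xa 1-pb 1-pa k =
      Regular-* (Regular-* (Regular-* (Regular-* 1-q 1-q) p) (Regular-* 1-xb 1-xa))
                (Regular-* (Regular-* (Regular-* (Regular-∏ 1-p k) (Regular-∏ 1-p k)) (Regular-∏ 1-pb k)) (Regular-∏ 1-pa k))

    private
      -- Because ab = 1, a and b enter the telescoping only through s = a+b, which leaves `Q-step`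
      -- as an identity in the three variables q, s and X.
      pair : ∀ y → (1# - y * b) * (1# - y * a) ≈ 1# - y * s + y * y
      pair y = begin
        (1# - y * b) * (1# - y * a)
          ≈⟨ solve 3 (λ y a b → (:1 :- y :* b) :* (:1 :- y :* a) := :1 :- y :* (a :+ b) :+ y :* y :* (a :* b)) refl y a b ⟩
        1# - y * s + y * y * (a * b)            ≈⟨ +-congˡ (trans (*-congˡ ab≈1) (*-identityʳ _)) ⟩
        1# - y * s + y * y                      ∎

      κ : Carrier
      κ = 1# - x * s + p

      ratio : Carrier → Carrier
      ratio y = (1# - y) * (1# - y) * (1# - y * s + y * y)

      -- The core of the summation: the relation between consecutive partial sums at X = p^k,
      -- stripped of its common Pochhammer factors. One κ stems from `closedDen`, the other from
      -- `ratio-r`.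
      Q-step : ∀ X → Q X * ratio (p * X)
        + (1# - q ^ 6 * (X * X)) * ((1# - q ^ 3 * X) * (1# - q ^ 3 * X)) * (1# - x) * X * (κ * κ)
        ≈ Q (p * X) * ratio (x * X)
      Q-step X = solve 3 (λ q s X →
        let w = :1 :- q :+ q :* q
            C = q :* (w :+ w :- q :* s)
            B = q :* q :* ((:1 :- q) :* (:1 :- q) :+ (w :+ w) :* s) :- (:1 :+ q :* q :* q) :* (:1 :+ q :* q :* q)
            Q = λ X → C :* (:1 :+ (q :* X) :* (q :* X)) :+ B :* X
            ratio = λ y → (:1 :- y) :* (:1 :- y) :* (:1 :- y :* s :+ y :* y)
            κ = :1 :- q :^ 2 :* s :+ q :^ 4
        in Q X :* ratio (q :^ 4 :* X)
             :+ (:1 :- q :^ 6 :* (X :* X)) :* ((:1 :- q :^ 3 :* X) :* (:1 :- q :^ 3 :* X)) :* (:1 :- q :^ 2) :* X :* (κ :* κ)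
           := Q (q :^ 4 :* X) :* ratio (q :^ 2 :* X)) refl q s X

      Q-one : Q 1# ≈ - ((1# - q) * (1# - q) * κ)
      Q-one = solve 2 (λ q s →
        let w = :1 :- q :+ q :* q
            C = q :* (w :+ w :- q :* s)
            B = q :* q :* ((:1 :- q) :* (:1 :- q) :+ (w :+ w) :* s) :- (:1 :+ q :* q :* q) :* (:1 :+ q :* q :* q)
        in C :* (:1 :+ (q :* :1) :* (q :* :1)) :+ B :* :1
           := S.:- ((:1 :- q) :* (:1 :- q) :* (:1 :- q :^ 2 :* s :+ q :^ 4))) refl q s

      pochs-suc : ∀ u k → pochs u (suc k) ≈ pochs u k * ratio (u * p ^ k)
      pochs-suc u k = begin
        P₁ * y * (P₁ * y) * (P₂ * (1# - u * b * X)) * (P₃ * (1# - u * a * X))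
          ≈⟨ solve 8 (λ u X a b P₁ P₂ P₃ y → P₁ :* y :* (P₁ :* y) :* (P₂ :* (:1 :- u :* b :* X)) :* (P₃ :* (:1 :- u :* a :* X))
                     := P₁ :* P₁ :* P₂ :* P₃ :* (y :* y :* ((:1 :- u :* X :* b) :* (:1 :- u :* X :* a)))) refl u X a b P₁ P₂ P₃ y ⟩
        pochs u k * (y * y * ((1# - u * X * b) * (1# - u * X * a)))
          ≈⟨ *-congˡ (*-congˡ (pair (u * X))) ⟩
        pochs u k * ratio (u * X) ∎
        where
        X = p ^ k
        y = 1# - u * X
        P₁ = qPoch u p k
        P₂ = qPoch (u * b) p k
        P₃ = qPoch (u * a) p k

      rp≈x : r * p ≈ x
      rp≈x = begin
        t ^ 2 * q ^ 4           ≈⟨ solve 2 (λ t q → t :^ 2 :* q :^ 4 := (t :* q) :* (t :* q) :* q :^ 2) refl t q ⟩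
        (t * q) * (t * q) * x   ≈⟨ *-congʳ (trans (*-cong tq≈1 tq≈1) (*-identityʳ 1#)) ⟩
        1# * x                  ≈⟨ *-identityˡ x ⟩
        x                       ∎

      rx≈1 : r * x ≈ 1#
      rx≈1 = begin
        t ^ 2 * q ^ 2           ≈⟨ solve 2 (λ t q → t :^ 2 :* q :^ 2 := (t :* q) :* (t :* q)) refl t q ⟩
        (t * q) * (t * q)       ≈⟨ trans (*-cong tq≈1 tq≈1) (*-identityʳ 1#) ⟩
        1#                      ∎

      -- Since q^(-2) q^4 = q^2, dropping the first factor of each symbol in the summand leaves
      -- exactly the symbols of the closed form.
      pochs-shift : ∀ k → pochs r (suc k) ≈ ratio r * pochs x k
      pochs-shift k = begin
        pochs r (suc k)
          ≈⟨ *-cong (*-cong (*-cong (part rp≈x) (part rp≈x)) (part (swap b))) (part (swap a)) ⟩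
        (1# - r) * P₁ * ((1# - r) * P₁) * ((1# - r * b) * P₂) * ((1# - r * a) * P₃)
          ≈⟨ solve 6 (λ u v w P₁ P₂ P₃ → u :* P₁ :* (u :* P₁) :* (v :* P₂) :* (w :* P₃) := u :* u :* (v :* w) :* (P₁ :* P₁ :* P₂ :* P₃))
                   refl (1# - r) (1# - r * b) (1# - r * a) P₁ P₂ P₃ ⟩
        (1# - r) * (1# - r) * ((1# - r * b) * (1# - r * a)) * pochs x k
          ≈⟨ *-congʳ (*-congˡ (pair r)) ⟩
        ratio r * pochs x k ∎
        where
        P₁ = qPoch x p k
        P₂ = qPoch (x * b) p k
        P₃ = qPoch (x * a) p k
        part : ∀ {u v} → u * p ≈ v → qPoch u p (suc k) ≈ (1# - u) * qPoch v p k
        part {u} up≈v = trans (qPoch-shift u p k) (*-congˡ (qPoch-cong up≈v refl k))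
        swap : ∀ c → r * c * p ≈ x * c
        swap c = trans (solve 3 (λ r c p → r :* c :* p := r :* p :* c) refl r c p) (*-congʳ rp≈x)

      -- The product p p = q^8 clears the negative powers of q. One p comes from the power of q in
      -- the summand, the other is the factor q^4 of `closedDen`.
      ratio-r : ratio r * (p * p) ≈ (1# - x) * (1# - x) * κ
      ratio-r = begin
        ratio r * (p * p)
          ≈⟨ solve 3 (λ q r s → (:1 :- r) :* (:1 :- r) :* (:1 :- r :* s :+ r :* r) :* (q :^ 4 :* q :^ 4)
                 := (q :^ 2 :- r :* q :^ 2) :* (q :^ 2 :- r :* q :^ 2) :* (q :^ 4 :- r :* q :^ 2 :* q :^ 2 :* s :+ r :* q :^ 2 :* (r :* q :^ 2))) refl q r s ⟩
        (x - r * x) * (x - r * x) * (p - r * x * x * s + r * x * (r * x))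
          ≈⟨ *-cong (*-cong x-1 x-1) (+-cong (+-congˡ (-‿cong (*-congʳ (*-congʳ rx≈1)))) (*-cong rx≈1 rx≈1)) ⟩
        (x - 1#) * (x - 1#) * (p - 1# * x * s + 1# * 1#)
          ≈⟨ solve 3 (λ x p s → (x :- :1) :* (x :- :1) :* (p :- :1 :* x :* s :+ :1 :* :1) := (:1 :- x) :* (:1 :- x) :* (:1 :- x :* s :+ p))
                   refl x p s ⟩
        (1# - x) * (1# - x) * κ ∎
        where
        x-1 : x - r * x ≈ x - 1#
        x-1 = +-congˡ (-‿cong rx≈1)

      κ-pair : (1# - x * b) * (1# - x * a) ≈ κ
      κ-pair = trans (pair x) (+-congˡ (solve 1 (λ q → q :^ 2 :* q :^ 2 := q :^ 4) refl q))

      closedDen-suc : ∀ k → closedDen (suc k) ≈ closedDen k * ratio (p * p ^ k)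
      closedDen-suc k = trans (*-congˡ (pochs-suc p k)) (sym (*-assoc _ _ _))

      -- Once common factors are removed this is `Q-step` at X = p^k. The first term carries
      -- `ratio (p * p ^ k)` because that is the quotient of consecutive values of `closedDen`.
      telescope : ∀ k → closedNum k * summandDen (suc k) * ratio (p * p ^ k) + summandNum k * closedDen (suc k)
                      ≈ closedNum (suc k) * summandDen (suc k)
      telescope k = begin
        Q X * G * (z * E * E * W) * ρ + n₁ * n₂ * n₂ * (pochs r (suc k) * (p * X)) * (E * E * p * ((1# - x * b) * (1# - x * a)) * W)
          ≈⟨ +-congˡ (*-cong (*-congˡ (*-congʳ (pochs-shift k))) (*-congʳ (*-congˡ κ-pair))) ⟩
        Q X * G * (z * E * E * W) * ρ + n₁ * n₂ * n₂ * (ratio r * G * (p * X)) * (E * E * p * κ * W)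
          ≈⟨ solve 12 (λ QX G z E W ρ n₁ n₂ ρr p X κ →
               QX :* G :* (z :* E :* E :* W) :* ρ :+ n₁ :* n₂ :* n₂ :* (ρr :* G :* (p :* X)) :* (E :* E :* p :* κ :* W)
               := G :* E :* E :* W :* (QX :* ρ :* z :+ n₁ :* (n₂ :* n₂) :* X :* κ :* (ρr :* (p :* p))))
               refl (Q X) G z E W ρ n₁ n₂ (ratio r) p X κ ⟩
        G * E * E * W * (Q X * ρ * z + n₁ * (n₂ * n₂) * X * κ * (ratio r * (p * p)))
          ≈⟨ *-congˡ (+-congˡ (*-congˡ ratio-r)) ⟩
        G * E * E * W * (Q X * ρ * z + n₁ * (n₂ * n₂) * X * κ * (z * z * κ))
          ≈⟨ solve 10 (λ QX G z E W ρ n₁ n₂ X κ →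
               G :* E :* E :* W :* (QX :* ρ :* z :+ n₁ :* (n₂ :* n₂) :* X :* κ :* (z :* z :* κ))
               := G :* (z :* E :* E :* W) :* (QX :* ρ :+ n₁ :* (n₂ :* n₂) :* z :* X :* (κ :* κ)))
               refl (Q X) G z E W ρ n₁ n₂ X κ ⟩
        G * (z * E * E * W) * (Q X * ρ + n₁ * (n₂ * n₂) * z * X * (κ * κ))
          ≈⟨ *-congˡ (Q-step X) ⟩
        G * (z * E * E * W) * (Q (p * X) * ratio (x * X))
          ≈⟨ solve 4 (λ G d QX ρ → G :* d :* (QX :* ρ) := QX :* (G :* ρ) :* d) refl G (z * E * E * W) (Q (p * X)) (ratio (x * X)) ⟩
        Q (p * X) * (G * ratio (x * X)) * (z * E * E * W)
          ≈⟨ *-congʳ (*-congˡ (pochs-suc x k)) ⟨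
        closedNum (suc k) * summandDen (suc k) ∎
        where
        X  = p ^ k
        G  = pochs x k
        W  = pochs p (suc k)
        E  = 1# - q
        z  = 1# - x
        ρ  = ratio (p * X)
        n₁ = 1# - q ^ 6 * (X * X)
        n₂ = 1# - q ^ 3 * X

    summandNum₀ : Carrier
    summandNum₀ = (1# - t ^ 2) * (1# - t) * (1# - t) * (pochs r 0 * 1#)

    closed-zero : summandNum₀ * closedDen 0 ≈ closedNum 0 * summandDen 0
    closed-zero = begin
      (1# - t ^ 2) * (1# - t) * (1# - t) * (1# * 1# * 1# * 1# * 1#) * (E * E * p * ((1# - x * b) * (1# - x * a)) * pochs p 0)
        ≈⟨ *-congˡ (*-congʳ (*-congˡ κ-pair)) ⟩
      (1# - t ^ 2) * (1# - t) * (1# - t) * (1# * 1# * 1# * 1# * 1#) * (E * E * p * κ * (1# * 1# * 1# * 1#))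
        -- The factor q^4 of `closedDen 0` absorbs t: q^4 (1-t^2) (1-t)^2 = (q^2-1) (q-1)^2.
        ≈⟨ solve 4 (λ q t E κ → (:1 :- t :^ 2) :* (:1 :- t) :* (:1 :- t) :* (:1 :* :1 :* :1 :* :1 :* :1) :* (E :* E :* q :^ 4 :* κ :* (:1 :* :1 :* :1 :* :1))
              := E :* E :* κ :* ((q :^ 2 :- (t :* q) :* (t :* q)) :* ((q :- t :* q) :* (q :- t :* q)))) refl q t E κ ⟩
      E * E * κ * ((x - (t * q) * (t * q)) * ((q - t * q) * (q - t * q)))
        ≈⟨ *-congˡ (*-cong (+-congˡ (-‿cong (*-cong tq≈1 tq≈1))) (*-cong (+-congˡ (-‿cong tq≈1)) (+-congˡ (-‿cong tq≈1)))) ⟩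
      E * E * κ * ((x - 1# * 1#) * ((q - 1#) * (q - 1#)))
        ≈⟨ solve 2 (λ q κ → let E = :1 :- q in E :* E :* κ :* ((q :^ 2 :- :1 :* :1) :* ((q :- :1) :* (q :- :1)))
              := (S.:- (E :* E :* κ)) :* (:1 :* :1 :* :1 :* :1) :* ((:1 :- q :^ 2) :* E :* E :* (:1 :* :1 :* :1 :* :1))) refl q κ ⟩
      - (E * E * κ) * pochs x 0 * summandDen 0
        ≈⟨ *-congʳ (*-congʳ Q-one) ⟨
      closedNum 0 * summandDen 0 ∎
      where E = 1# - q

    -- `den` is arbitrary, so the unreduced denominator of a partial sum, a product over all
    -- summands, never has to be evaluated.
    closed-suc : ∀ k num den → num * closedDen k ≈ closedNum k * den →
      (num * summandDen (suc k) + summandNum k * den) * closedDen (suc k) ≈ closedNum (suc k) * (den * summandDen (suc k))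
    closed-suc k num den eq = begin
      (num * d + n * den) * closedDen (suc k)
        ≈⟨ solve 5 (λ num d n den c → (num :* d :+ n :* den) :* c := num :* d :* c :+ n :* c :* den) refl num d n den (closedDen (suc k)) ⟩
      num * d * closedDen (suc k) + n * closedDen (suc k) * den
        ≈⟨ +-congʳ (*-congˡ (closedDen-suc k)) ⟩
      num * d * (closedDen k * ρ) + n * closedDen (suc k) * den
        ≈⟨ +-congʳ (solve 4 (λ num d c ρ → num :* d :* (c :* ρ) := num :* c :* d :* ρ) refl num d (closedDen k) ρ) ⟩
      num * closedDen k * d * ρ + n * closedDen (suc k) * den
        ≈⟨ +-congʳ (*-congʳ (*-congʳ eq)) ⟩
      closedNum k * den * d * ρ + n * closedDen (suc k) * den
        ≈⟨ solve 5 (λ c den d ρ m → c :* den :* d :* ρ :+ m :* den := (c :* d :* ρ :+ m) :* den)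
                 refl (closedNum k) den d ρ (n * closedDen (suc k)) ⟩
      (closedNum k * d * ρ + n * closedDen (suc k)) * den
        ≈⟨ *-congʳ (telescope k) ⟩
      closedNum (suc k) * d * den
        ≈⟨ trans (*-assoc _ _ _) (*-congˡ (*-comm _ _)) ⟩
      closedNum (suc k) * (den * d) ∎
      where
      d = summandDen (suc k)
      n = summandNum k
      ρ = ratio (p * p ^ k)

    -- The modulus as a factor of the closed form

    module Divisibility (regular : ∀ j → Regular (1# - x ^ suc j)) where
      open Binomial x regular

      cofactor : ℕ → Carrier
      cofactor k = (1# - q) * (1# - q) * (clearing k * clearing k) * (qPoch (p * b) p k * qPoch (p * a) p k)

      private
        xx≈p : x * x ≈ p
        xx≈p = solve 1 (λ q → q :^ 2 :* q :^ 2 := q :^ 4) refl q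

        x[p^]≈x^ : ∀ i → x * p ^ i ≈ x ^ suc (i ℕ.+ i)
        x[p^]≈x^ i = *-congˡ (trans (^-congˡ i (sym xx≈p)) (trans (^-distrib-* x x i) (sym (^-homo-* x i i))))

        -- The factor with index 0 cancels against `closedDen`. The factor with index i+1 is 1-c
        -- x^n, since x p^(i+1) = x^(2i+3); it is a different one, and i < k places it inside the
        -- product.
        two-factors : ∀ c {i k} → i ℕ.< k → ∃ λ h →
          qPoch (x * c) p (suc k) ≈ (1# - x * c) * ((1# - c * x ^ suc (suc i ℕ.+ suc i)) * h)
        two-factors c {i} {k} i<k with qPoch-factor (x * c * p) p i<k
        ... | h , eq = h , (begin
          qPoch (x * c) p (suc k)                                            ≈⟨ qPoch-shift (x * c) p k ⟩
          (1# - x * c) * qPoch (x * c * p) p k                               ≈⟨ *-congˡ eq ⟩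
          (1# - x * c) * ((1# - x * c * p * p ^ i) * h)                      ≈⟨ *-congˡ (*-congʳ (1-cong
            (trans (solve 4 (λ x c p P → x :* c :* p :* P := c :* (x :* (p :* P))) refl x c p (p ^ i)) (*-congˡ (x[p^]≈x^ (suc i)))))) ⟩
          (1# - x * c) * ((1# - c * x ^ suc (suc i ℕ.+ suc i)) * h)          ∎)

      divides : ∀ i k c → i ℕ.< k → let n = suc (suc i ℕ.+ suc i) in
        (1# - x ^ suc k) * qBinomial (suc k) (suc k) ≈ (1# - x ^ n) * c →
        ∃ λ N → closedNum (suc k) * cofactor (suc k)
              ≈ geom x n * geom x n * (1# - a * x ^ n) * (a - x ^ n) * N * closedDen (suc k)
      divides i k c i<k eq with two-factors a i<k | two-factors b i<k
      -- Here c appears once for each use of `odd-clearing`, b comes from 1-bz = b(a-z), and t^4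
      -- compensates the factor p of `closedDen`.
      ... | hₐ , eqₐ | h_b , eq_b = Q (p ^ M) * (c * c) * (b * hₐ * h_b) * (t ^ 4) , (begin
        Q (p ^ M) * (o * o * qPoch (x * b) p M * qPoch (x * a) p M) * (E * E * (K * K) * (Pb * Pa))
          ≈⟨ *-congʳ (*-congˡ (*-cong (*-cong (*-cong o≈ o≈) eq_b) eqₐ)) ⟩
        Q (p ^ M) * (oddPart M * oddPart M * ((1# - x * b) * ((1# - b * z) * h_b)) * ((1# - x * a) * ((1# - a * z) * hₐ))) * (E * E * (K * K) * (Pb * Pa))
          ≈⟨ solve 12 (λ QX o xb bz h_b xa az hₐ E K Pb Pa →
               QX :* (o :* o :* (xb :* (bz :* h_b)) :* (xa :* (az :* hₐ))) :* (E :* E :* (K :* K) :* (Pb :* Pa))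
               := (o :* K) :* (o :* K) :* (QX :* az :* bz :* hₐ :* h_b :* (E :* E :* (xb :* xa) :* (Pb :* Pa))))
               refl (Q (p ^ M)) (oddPart M) (1# - x * b) (1# - b * z) h_b (1# - x * a) (1# - a * z) hₐ E K Pb Pa ⟩
        (oddPart M * K) * (oddPart M * K) * (Q (p ^ M) * (1# - a * z) * (1# - b * z) * hₐ * h_b * (E * E * κ′ * (Pb * Pa)))
          ≈⟨ *-cong (*-cong oK≈ oK≈) (*-congʳ (*-congʳ (*-congʳ (*-congˡ bz≈)))) ⟩
        (g * c * Pp) * (g * c * Pp) * (Q (p ^ M) * (1# - a * z) * (b * (a - z)) * hₐ * h_b * (E * E * κ′ * (Pb * Pa)))
          ≈⟨ *-congˡ (trans (sym (*-identityʳ _)) (*-congˡ (sym t⁴p≈1))) ⟩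
        (g * c * Pp) * (g * c * Pp) * (Q (p ^ M) * (1# - a * z) * (b * (a - z)) * hₐ * h_b * (E * E * κ′ * (Pb * Pa)) * (t ^ 4 * p))
          ≈⟨ shuffle ⟩
        g * g * (1# - a * z) * (a - z) * (Q (p ^ M) * (c * c) * (b * hₐ * h_b) * (t ^ 4)) * (E * E * p * κ′ * (Pp * Pp * Pb * Pa)) ∎)
        where
        n = suc (suc i ℕ.+ suc i)
        M = suc k
        z = x ^ n
        E = 1# - q
        K = clearing M
        g = geom x n
        o = qPoch x p M
        Pp = qPoch p p M
        Pb = qPoch (p * b) p M
        Pa = qPoch (p * a) p M
        κ′ = (1# - x * b) * (1# - x * a)
        o≈ : o ≈ oddPart M
        o≈ = qPoch-cong refl (sym xx≈p) M
        oK≈ : oddPart M * K ≈ g * c * Pp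
        oK≈ = trans (odd-clearing k n c eq) (*-congˡ (qPoch-cong xx≈p xx≈p M))
        bz≈ : 1# - b * z ≈ b * (a - z)
        bz≈ = sym (begin
          b * (a - z)         ≈⟨ solve 3 (λ a b z → b :* (a :- z) := a :* b :- b :* z) refl a b z ⟩
          a * b - b * z       ≈⟨ +-congʳ ab≈1 ⟩
          1# - b * z          ∎)
        t⁴p≈1 : t ^ 4 * p ≈ 1#
        t⁴p≈1 = begin
          t ^ 4 * q ^ 4       ≈⟨ solve 2 (λ t q → t :^ 4 :* q :^ 4 := (t :* q) :^ 4) refl t q ⟩
          (t * q) ^ 4         ≈⟨ ^-congˡ 4 tq≈1 ⟩
          1# ^ 4              ≈⟨ solve 1 (λ q → :1 :^ 4 := :1) refl q ⟩
          1#                  ∎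
        shuffle : _ ≈ _
        shuffle = solve 15 (λ g c Pp QX az az′ b hₐ h_b E κ′ Pb Pa t⁴ p →
            (g :* c :* Pp) :* (g :* c :* Pp) :* (QX :* az :* (b :* az′) :* hₐ :* h_b :* (E :* E :* κ′ :* (Pb :* Pa)) :* (t⁴ :* p))
            := g :* g :* az :* az′ :* (QX :* (c :* c) :* (b :* hₐ :* h_b) :* t⁴) :* (E :* E :* p :* κ′ :* (Pp :* Pp :* Pb :* Pa)))
            refl g c Pp (Q (p ^ M)) (1# - a * z) (a - z) b hₐ h_b E κ′ Pb Pa (t ^ 4) p

-- The ring of Laurent polynomials

open import Data.Nat using (ℕ; _+_; _∸_; _<_; _%_; _/_)
open import Relation.Binary.PropositionalEquality using (_≡_; _≢_; refl; sym; trans; cong; cong₂; subst; subst₂; module ≡-Reasoning)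

coeff-miss : ∀ c x y p {i j} → (x , y) ≢ (i , j) → coeff (tm c x y ∷ p) i j ≡ coeff p i j
coeff-miss c x y p {i} {j} x≢i with x I.≟ i | y I.≟ j
... | yes refl | yes refl = ⊥-elim (x≢i refl)
... | yes _    | no _     = refl
... | no _     | yes _    = refl
... | no _     | no _     = refl

coeff-hit : ∀ c x y p → coeff (tm c x y ∷ p) x y ≡ c I.+ coeff p x y
coeff-hit c x y p with x I.≟ x | y I.≟ y
... | yes _  | yes _  = refl
... | no x≢x | _      = ⊥-elim (x≢x refl)
... | yes _  | no y≢y = ⊥-elim (y≢y refl)

coeff-⊕ : ∀ p r i j → coeff (p ⊕ r) i j ≡ coeff p i j I.+ coeff r i j
coeff-⊕ []             r i j = sym (I.+-identityˡ _)
coeff-⊕ (tm c x y ∷ p) r i j with x I.≟ i | y I.≟ j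
... | yes _ | yes _ = trans (cong (λ z → c I.+ z) (coeff-⊕ p r i j)) (sym (I.+-assoc c _ _))
... | yes _ | no _  = coeff-⊕ p r i j
... | no _  | yes _ = coeff-⊕ p r i j
... | no _  | no _  = coeff-⊕ p r i j

coeff-neg : ∀ p i j → coeff (neg p) i j ≡ I.- coeff p i j
coeff-neg []             i j = refl
coeff-neg (tm c x y ∷ p) i j with x I.≟ i | y I.≟ j
... | yes _ | yes _ = trans (cong (λ z → I.- c I.+ z) (coeff-neg p i j)) (sym (I.neg-distrib-+ c _))
... | yes _ | no _  = coeff-neg p i j
... | no _  | yes _ = coeff-neg p i j
... | no _  | no _  = coeff-neg p i j

private
  add-sub : ∀ x u → x I.+ u I.- x ≡ u
  add-sub = I.solve-∀

  sub-add : ∀ x i → x I.+ (i I.- x) ≡ i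
  sub-add = I.solve-∀

coeff-mon⊗ : ∀ c x y r i j →
  coeff (mon c x y ⊗ r) i j ≡ c I.* coeff r (i I.- x) (j I.- y)
coeff-mon⊗ c x y []             i j = sym (I.*-zeroʳ c)
coeff-mon⊗ c x y (tm d u v ∷ r) i j with u I.≟ i I.- x | v I.≟ j I.- y
... | yes refl | yes refl = begin
  coeff (mon c x y ⊗ (tm d u v ∷ r)) i j
    ≡⟨ cong₂ (coeff (mon c x y ⊗ (tm d u v ∷ r))) (sub-add x i) (sub-add y j) ⟨
  coeff (mon c x y ⊗ (tm d u v ∷ r)) (x I.+ u) (y I.+ v)
    ≡⟨ coeff-hit (c I.* d) (x I.+ u) (y I.+ v) (mon c x y ⊗ r) ⟩
  c I.* d I.+ coeff (mon c x y ⊗ r) (x I.+ u) (y I.+ v)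
    ≡⟨ cong (λ z → c I.* d I.+ z) (cong₂ (coeff (mon c x y ⊗ r)) (sub-add x i) (sub-add y j)) ⟩
  c I.* d I.+ coeff (mon c x y ⊗ r) i j
    ≡⟨ cong (λ z → c I.* d I.+ z) (coeff-mon⊗ c x y r i j) ⟩
  c I.* d I.+ c I.* coeff r u v
    ≡⟨ I.*-distribˡ-+ c d _ ⟨
  c I.* (d I.+ coeff r u v) ∎
  where open ≡-Reasoning
... | no u≢ | _ = trans (coeff-miss (c I.* d) (x I.+ u) (y I.+ v) (mon c x y ⊗ r) λ { refl → u≢ (sym (add-sub x u)) })
                        (coeff-mon⊗ c x y r i j)
... | yes _ | no v≢ = trans (coeff-miss (c I.* d) (x I.+ u) (y I.+ v) (mon c x y ⊗ r) λ { refl → v≢ (sym (add-sub y v)) })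
                            (coeff-mon⊗ c x y r i j)

∷-⊗ : ∀ t p r → (t ∷ p) ⊗ r ≡ (t ∷ []) ⊗ r ⊕ p ⊗ r
∷-⊗ t p r = cong (_++ p ⊗ r) (sym (++-identityʳ _))

-- Multiplication by a monomial shifts the coefficient function. Equal polynomials may be different
-- lists, so most ring laws for `⊗` are checked on coefficients through this recursion.
coeff-∷⊗ : ∀ c x y p r i j →
  coeff ((tm c x y ∷ p) ⊗ r) i j ≡ c I.* coeff r (i I.- x) (j I.- y) I.+ coeff (p ⊗ r) i j
coeff-∷⊗ c x y p r i j = begin
  coeff ((tm c x y ∷ p) ⊗ r) i j                        ≡⟨ cong (λ z → coeff z i j) (∷-⊗ (tm c x y) p r) ⟩
  coeff (mon c x y ⊗ r ⊕ p ⊗ r) i j                     ≡⟨ coeff-⊕ (mon c x y ⊗ r) _ i j ⟩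
  coeff (mon c x y ⊗ r) i j I.+ coeff (p ⊗ r) i j       ≡⟨ cong (I._+ _) (coeff-mon⊗ c x y r i j) ⟩
  c I.* coeff r (i I.- x) (j I.- y) I.+ coeff (p ⊗ r) i j ∎
  where open ≡-Reasoning

-- ≈ₚ unfolds to a Π-type, from which its two sides cannot be inferred.
infix 4 _≋_
record _≋_ (p r : LPoly) : Set where
  constructor mk
  field at : p ≈ₚ r
open _≋_ public

≋-refl : ∀ {p} → p ≋ p
≋-refl = mk λ i j → refl

≋-sym : ∀ {p r} → p ≋ r → r ≋ p
≋-sym e = mk λ i j → sym (at e i j)

≋-trans : ∀ {p r s} → p ≋ r → r ≋ s → p ≋ s
≋-trans e f = mk λ i j → trans (at e i j) (at f i j)

≋-reflexive : ∀ {p r} → p ≡ r → p ≋ r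
≋-reflexive refl = ≋-refl

⊕-cong : ∀ {p p′ r r′} → p ≋ p′ → r ≋ r′ → p ⊕ r ≋ p′ ⊕ r′
⊕-cong {p} {p′} {r} {r′} e f = mk λ i j →
  trans (coeff-⊕ p r i j) (trans (cong₂ I._+_ (at e i j) (at f i j)) (sym (coeff-⊕ p′ r′ i j)))

⊕-assoc : ∀ p r s → p ⊕ r ⊕ s ≋ p ⊕ (r ⊕ s)
⊕-assoc p r s = mk λ i j → begin
  coeff (p ⊕ r ⊕ s) i j                             ≡⟨ coeff-⊕ (p ⊕ r) s i j ⟩
  coeff (p ⊕ r) i j I.+ coeff s i j                 ≡⟨ cong (I._+ coeff s i j) (coeff-⊕ p r i j) ⟩
  coeff p i j I.+ coeff r i j I.+ coeff s i j       ≡⟨ I.+-assoc (coeff p i j) _ _ ⟩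
  coeff p i j I.+ (coeff r i j I.+ coeff s i j)     ≡⟨ cong (λ z → coeff p i j I.+ z) (coeff-⊕ r s i j) ⟨
  coeff p i j I.+ coeff (r ⊕ s) i j                 ≡⟨ coeff-⊕ p (r ⊕ s) i j ⟨
  coeff (p ⊕ (r ⊕ s)) i j                           ∎
  where open ≡-Reasoning

⊕-comm : ∀ p r → p ⊕ r ≋ r ⊕ p
⊕-comm p r = mk λ i j →
  trans (coeff-⊕ p r i j) (trans (I.+-comm (coeff p i j) _) (sym (coeff-⊕ r p i j)))

⊕-identityˡ : ∀ p → [] ⊕ p ≋ p
⊕-identityˡ p = ≋-refl

⊕-inverseʳ : ∀ p → p ⊕ neg p ≋ []
⊕-inverseʳ p = mk λ i j → begin
  coeff (p ⊕ neg p) i j                 ≡⟨ coeff-⊕ p (neg p) i j ⟩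
  coeff p i j I.+ coeff (neg p) i j     ≡⟨ cong (λ z → coeff p i j I.+ z) (coeff-neg p i j) ⟩
  coeff p i j I.- coeff p i j           ≡⟨ I.+-inverseʳ (coeff p i j) ⟩
  0ℤ                                    ∎
  where open ≡-Reasoning

neg-cong : ∀ {p r} → p ≋ r → neg p ≋ neg r
neg-cong {p} {r} e = mk λ i j →
  trans (coeff-neg p i j) (trans (cong I.-_ (at e i j)) (sym (coeff-neg r i j)))

⊗-congʳ : ∀ p {r r′} → r ≋ r′ → p ⊗ r ≋ p ⊗ r′
⊗-congʳ []             e = ≋-refl
⊗-congʳ (tm c x y ∷ p) {r} {r′} e = mk λ i j → begin
  coeff ((tm c x y ∷ p) ⊗ r) i j                                ≡⟨ coeff-∷⊗ c x y p r i j ⟩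
  c I.* coeff r (i I.- x) (j I.- y) I.+ coeff (p ⊗ r) i j       ≡⟨ cong₂ (λ u v → c I.* u I.+ v) (at e _ _) (at (⊗-congʳ p e) i j) ⟩
  c I.* coeff r′ (i I.- x) (j I.- y) I.+ coeff (p ⊗ r′) i j     ≡⟨ coeff-∷⊗ c x y p r′ i j ⟨
  coeff ((tm c x y ∷ p) ⊗ r′) i j                               ∎
  where open ≡-Reasoning

⊗-distribʳ : ∀ s p r → (p ⊕ r) ⊗ s ≋ p ⊗ s ⊕ r ⊗ s
⊗-distribʳ s p r = ≋-reflexive (concatMap-++ _ p r)

⊗-zeroʳ : ∀ p → p ⊗ [] ≋ []
⊗-zeroʳ []      = ≋-refl
⊗-zeroʳ (_ ∷ p) = ⊗-zeroʳ p

⊗-distribˡ : ∀ p r s → p ⊗ (r ⊕ s) ≋ p ⊗ r ⊕ p ⊗ s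
⊗-distribˡ []             r s = ≋-refl
⊗-distribˡ (tm c x y ∷ p) r s = mk λ i j → begin
  coeff ((tm c x y ∷ p) ⊗ (r ⊕ s)) i j
    ≡⟨ coeff-∷⊗ c x y p (r ⊕ s) i j ⟩
  c I.* coeff (r ⊕ s) (i I.- x) (j I.- y) I.+ coeff (p ⊗ (r ⊕ s)) i j
    ≡⟨ cong₂ (λ u v → c I.* u I.+ v) (coeff-⊕ r s _ _)
             (trans (at (⊗-distribˡ p r s) i j) (coeff-⊕ (p ⊗ r) (p ⊗ s) i j)) ⟩
  c I.* (coeff r (i I.- x) (j I.- y) I.+ coeff s (i I.- x) (j I.- y)) I.+ (coeff (p ⊗ r) i j I.+ coeff (p ⊗ s) i j)
    ≡⟨ rearrange c _ _ _ _ ⟩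
  (c I.* coeff r (i I.- x) (j I.- y) I.+ coeff (p ⊗ r) i j) I.+ (c I.* coeff s (i I.- x) (j I.- y) I.+ coeff (p ⊗ s) i j)
    ≡⟨ cong₂ I._+_ (coeff-∷⊗ c x y p r i j) (coeff-∷⊗ c x y p s i j) ⟨
  coeff ((tm c x y ∷ p) ⊗ r) i j I.+ coeff ((tm c x y ∷ p) ⊗ s) i j
    ≡⟨ coeff-⊕ ((tm c x y ∷ p) ⊗ r) _ i j ⟨
  coeff ((tm c x y ∷ p) ⊗ r ⊕ (tm c x y ∷ p) ⊗ s) i j ∎
  where
  open ≡-Reasoning
  rearrange : ∀ c u v w z → c I.* (u I.+ v) I.+ (w I.+ z) ≡ (c I.* u I.+ w) I.+ (c I.* v I.+ z)
  rearrange = I.solve-∀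

⊗-mon-comm : ∀ p t → p ⊗ (t ∷ []) ≡ (t ∷ []) ⊗ p
⊗-mon-comm []             (tm d u v) = refl
⊗-mon-comm (tm c x y ∷ p) (tm d u v) = cong₂ _∷_
  (trans (cong (λ z → tm z _ _) (I.*-comm c d)) (cong₂ (tm _) (I.+-comm x u) (I.+-comm y v)))
  (⊗-mon-comm p (tm d u v))

⊗-comm : ∀ p r → p ⊗ r ≋ r ⊗ p
⊗-comm p []      = ⊗-zeroʳ p
⊗-comm p (t ∷ r) = ≋-trans (⊗-distribˡ p (t ∷ []) r)
  (≋-trans (⊕-cong (≋-reflexive (⊗-mon-comm p t)) (⊗-comm p r)) (≋-reflexive (sym (∷-⊗ t r p))))

mon⊗-assoc : ∀ t r s → ((t ∷ []) ⊗ r) ⊗ s ≋ (t ∷ []) ⊗ (r ⊗ s)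
mon⊗-assoc t               []             s = ≋-refl
mon⊗-assoc t@(tm c x y) (tm d u v ∷ r) s = mk λ i j → begin
  coeff (((t ∷ []) ⊗ (tm d u v ∷ r)) ⊗ s) i j
    ≡⟨ coeff-∷⊗ (c I.* d) (x I.+ u) (y I.+ v) ((t ∷ []) ⊗ r) s i j ⟩
  c I.* d I.* coeff s (i I.- (x I.+ u)) (j I.- (y I.+ v)) I.+ coeff (((t ∷ []) ⊗ r) ⊗ s) i j
    ≡⟨ cong₂ I._+_ (cong (c I.* d I.*_) (cong₂ (coeff s) (sub-sub i x u) (sub-sub j y v)))
                   (trans (at (mon⊗-assoc t r s) i j) (coeff-mon⊗ c x y (r ⊗ s) i j)) ⟩
  c I.* d I.* coeff s (i I.- x I.- u) (j I.- y I.- v) I.+ c I.* coeff (r ⊗ s) (i I.- x) (j I.- y)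
    ≡⟨ factor c d _ _ ⟩
  c I.* (d I.* coeff s (i I.- x I.- u) (j I.- y I.- v) I.+ coeff (r ⊗ s) (i I.- x) (j I.- y))
    ≡⟨ cong (c I.*_) (coeff-∷⊗ d u v r s _ _) ⟨
  c I.* coeff ((tm d u v ∷ r) ⊗ s) (i I.- x) (j I.- y)
    ≡⟨ coeff-mon⊗ c x y ((tm d u v ∷ r) ⊗ s) i j ⟨
  coeff ((t ∷ []) ⊗ ((tm d u v ∷ r) ⊗ s)) i j ∎
  where
  open ≡-Reasoning
  sub-sub : ∀ i x u → i I.- (x I.+ u) ≡ i I.- x I.- u
  sub-sub = I.solve-∀
  factor : ∀ c d m n → c I.* d I.* m I.+ c I.* n ≡ c I.* (d I.* m I.+ n)
  factor = I.solve-∀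

⊗-congˡ : ∀ {p p′} r → p ≋ p′ → p ⊗ r ≋ p′ ⊗ r
⊗-congˡ {p} {p′} r e = ≋-trans (⊗-comm p r) (≋-trans (⊗-congʳ r e) (⊗-comm r p′))

⊗-assoc : ∀ p r s → p ⊗ r ⊗ s ≋ p ⊗ (r ⊗ s)
⊗-assoc []      r s = ≋-refl
⊗-assoc (t ∷ p) r s =
  ≋-trans (⊗-congˡ s (≋-reflexive (∷-⊗ t p r)))
  (≋-trans (⊗-distribʳ s ((t ∷ []) ⊗ r) (p ⊗ r))
  (≋-trans (⊕-cong (mon⊗-assoc t r s) (⊗-assoc p r s)) (≋-reflexive (sym (∷-⊗ t p (r ⊗ s))))))

⊗-cong : ∀ {p p′ r r′} → p ≋ p′ → r ≋ r′ → p ⊗ r ≋ p′ ⊗ r′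
⊗-cong {p} {p′} {r} {r′} e f = ≋-trans (⊗-congˡ r e) (⊗-congʳ p′ f)

⊗-identityˡ : ∀ p → one ⊗ p ≋ p
⊗-identityˡ p = mk λ i j → begin
  coeff (one ⊗ p) i j                          ≡⟨ coeff-mon⊗ 1ℤ 0ℤ 0ℤ p i j ⟩
  1ℤ I.* coeff p (i I.- 0ℤ) (j I.- 0ℤ)         ≡⟨ I.*-identityˡ _ ⟩
  coeff p (i I.- 0ℤ) (j I.- 0ℤ)                ≡⟨ cong₂ (coeff p) (I.+-identityʳ i) (I.+-identityʳ j) ⟩
  coeff p i j                                  ∎
  where open ≡-Reasoning

laurentRing : CommutativeRing 0ℓ 0ℓ
laurentRing = record
  { Carrier = LPoly
  ; _≈_     = _≋_
  ; _+_     = _⊕_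
  ; _*_     = _⊗_
  ; -_      = neg
  ; 0#      = []
  ; 1#      = one
  ; isCommutativeRing = record
    { isRing = record
      { +-isAbelianGroup = record
        { isGroup = record
          { isMonoid = record
            { isSemigroup = record
              { isMagma = record
                { isEquivalence = record { refl = ≋-refl ; sym = ≋-sym ; trans = ≋-trans }
                ; ∙-cong        = ⊕-cong
                }
              ; assoc = ⊕-assoc
              }
            ; identity = ⊕-identityˡ , λ p → ≋-trans (⊕-comm p []) (⊕-identityˡ p)
            }
          ; inverse = (λ p → ≋-trans (⊕-comm (neg p) p) (⊕-inverseʳ p)) , ⊕-inverseʳ
          ; ⁻¹-cong = neg-cong
          }
        ; comm = ⊕-comm
        }
      ; *-cong     = ⊗-cong
      ; *-assoc    = ⊗-assoc
      ; *-identity = ⊗-identityˡ , λ p → ≋-trans (⊗-comm p one) (⊗-identityˡ p)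
      ; distrib    = ⊗-distribˡ , ⊗-distribʳ
      }
    ; *-comm = ⊗-comm
    }
  }

-- Leading exponents

-- Translation invariance is what makes leading exponents add under multiplication. The order is
-- kept abstract because three different ones are compared.
record AdditiveOrder {A : Set} (_∙_ : A → A → A) : Set₁ where
  infix 4 _≺_
  field
    _≺_     : A → A → Set
    compare : Trichotomous _≡_ _≺_
    ≺-trans : Transitive _≺_
    ≺-mono  : ∀ {x y} z → x ≺ y → (x ∙ z) ≺ (y ∙ z)

  ≺-irrefl : ∀ {x} → ¬ (x ≺ x)
  ≺-irrefl {x} x≺x with compare x x
  ... | tri< _ x≢x _ = x≢x refl
  ... | tri≈ x⊀x _ _ = x⊀x x≺x
  ... | tri> _ x≢x _ = x≢x refl

open AdditiveOrder using (≺-irrefl)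

ascending : AdditiveOrder I._+_
ascending = record
  { _≺_     = I._<_
  ; compare = I.<-cmp
  ; ≺-trans = I.<-trans
  ; ≺-mono  = λ z → I.+-monoˡ-< z
  }

opposite : ∀ {A : Set} {_∙_ : A → A → A} → AdditiveOrder _∙_ → AdditiveOrder _∙_
opposite O = record
  { _≺_     = λ x y → y ≺ x
  ; compare = λ x y → flip-tri (compare y x)
  ; ≺-trans = λ x≻y y≻z → ≺-trans y≻z x≻y
  ; ≺-mono  = ≺-mono
  }
  where
  open AdditiveOrder O
  flip-tri : ∀ {x y} → Tri (y ≺ x) (y ≡ x) (x ≺ y) → Tri (y ≺ x) (x ≡ y) (x ≺ y)
  flip-tri (tri< a b c) = tri< a (b ∘ sym) c
  flip-tri (tri≈ a b c) = tri≈ a (sym b) c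
  flip-tri (tri> a b c) = tri> a (b ∘ sym) c

-- (i , j) is the exponent of the monomial qⁱaʲ.
Exponent : Set
Exponent = ℤ × ℤ

infixl 6 _⊞_ _⊟_
_⊞_ _⊟_ : Exponent → Exponent → Exponent
(i , j) ⊞ (k , l) = i I.+ k , j I.+ l
(i , j) ⊟ (k , l) = i I.- k , j I.- l

⊞-comm : ∀ d e → d ⊞ e ≡ e ⊞ d
⊞-comm (i , j) (k , l) = cong₂ _,_ (I.+-comm i k) (I.+-comm j l)

d⊞e⊟d≡e : ∀ d e → d ⊞ e ⊟ d ≡ e
d⊞e⊟d≡e (i , j) (k , l) = cong₂ _,_ (lemma i k) (lemma j l)
  where
  lemma : ∀ x y → x I.+ y I.- x ≡ y
  lemma = I.solve-∀

-- Exponents of a are compared first.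
lex : AdditiveOrder I._+_ → AdditiveOrder I._+_ → AdditiveOrder _⊞_
lex O₁ O₂ = record
  { _≺_     = _≺_
  ; compare = compare
  ; ≺-trans = λ where
      (inj₁ x)          (inj₁ y)          → inj₁ (O₁.≺-trans x y)
      (inj₁ x)          (inj₂ (refl , _)) → inj₁ x
      (inj₂ (refl , _)) (inj₁ y)          → inj₁ y
      (inj₂ (refl , x)) (inj₂ (refl , y)) → inj₂ (refl , O₂.≺-trans x y)
  ; ≺-mono  = λ where
      (k , l) (inj₁ x)          → inj₁ (O₁.≺-mono l x)
      (k , l) (inj₂ (refl , x)) → inj₂ (refl , O₂.≺-mono k x)
  }
  where
  module O₁ = AdditiveOrder O₁
  module O₂ = AdditiveOrder O₂
  _≺_ : Exponent → Exponent → Set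
  (i , j) ≺ (k , l) = (j O₁.≺ l) ⊎ (j ≡ l × i O₂.≺ k)
  compare : Trichotomous _≡_ _≺_
  compare (i , j) (k , l) with O₁.compare j l
  ... | tri< j≺l j≢l l⊀j = tri< (inj₁ j≺l) (j≢l ∘ cong proj₂)
                                λ { (inj₁ l≺j) → l⊀j l≺j ; (inj₂ (l≡j , _)) → j≢l (sym l≡j) }
  ... | tri> j⊀l j≢l l≺j = tri> (λ { (inj₁ j≺l) → j⊀l j≺l ; (inj₂ (j≡l , _)) → j≢l j≡l })
                                (j≢l ∘ cong proj₂) (inj₁ l≺j)
  ... | tri≈ j⊀l refl l⊀j with O₂.compare i k
  ...   | tri< i≺k i≢k k⊀i  = tri< (inj₂ (refl , i≺k)) (i≢k ∘ cong proj₁)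
                                   λ { (inj₁ l≺j) → l⊀j l≺j ; (inj₂ (_ , k≺i)) → k⊀i k≺i }
  ...   | tri≈ i⊀k refl k⊀i = tri≈ (λ { (inj₁ j≺l) → j⊀l j≺l ; (inj₂ (_ , i≺k)) → i⊀k i≺k }) refl
                                   (λ { (inj₁ l≺j) → l⊀j l≺j ; (inj₂ (_ , k≺i)) → k⊀i k≺i })
  ...   | tri> i⊀k i≢k k≺i  = tri> (λ { (inj₁ j≺l) → j⊀l j≺l ; (inj₂ (_ , i≺k)) → i⊀k i≺k })
                                   (i≢k ∘ cong proj₁) (inj₂ (refl , k≺i))

coeffAt : LPoly → Exponent → ℤ
coeffAt p (i , j) = coeff p i j

exponent : Term → Exponent
exponent (tm c i j) = i , j

monAt : ℤ → Exponent → LPoly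
monAt c (i , j) = mon c i j

coeffAt-monAt⊗ : ∀ c e r d → coeffAt (monAt c e ⊗ r) d ≡ c I.* coeffAt r (d ⊟ e)
coeffAt-monAt⊗ c (x , y) r (i , j) = coeff-mon⊗ c x y r i j

coeffAt-mon-hit : ∀ c e → coeffAt (monAt c e) e ≡ c
coeffAt-mon-hit c (i , j) = trans (coeff-hit c i j []) (I.+-identityʳ c)

coeffAt-mon-miss : ∀ c {e d} → e ≢ d → coeffAt (monAt c e) d ≡ 0ℤ
coeffAt-mon-miss c {i , j} {k , l} e≢d = coeff-miss c i j [] e≢d

coeffAt-⊕ : ∀ p r e → coeffAt (p ⊕ r) e ≡ coeffAt p e I.+ coeffAt r e
coeffAt-⊕ p r (i , j) = coeff-⊕ p r i j

-- An exponent that no term of the list carries has coefficient zero.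
support : ∀ (Q : Exponent → Set) p → All (Q ∘ exponent) p → ∀ e → Q e ⊎ coeffAt p e ≡ 0ℤ
support Q []             []       e = inj₂ refl
support Q (tm c x y ∷ p) (qt ∷ qp) (i , j) with x I.≟ i | y I.≟ j
... | yes refl | yes refl = inj₁ qt
... | yes _    | no _     = support Q p qp (i , j)
... | no _     | yes _    = support Q p qp (i , j)
... | no _     | no _     = support Q p qp (i , j)

module _ (Q : Exponent → Set) (Q? : ∀ e → Dec (Q e)) where

  restrict : LPoly → LPoly
  restrict = filter (Q? ∘ exponent)

  restrict-in : ∀ p {e} → Q e → coeffAt (restrict p) e ≡ coeffAt p e
  restrict-in []                       qe = refl
  restrict-in (tm c x y ∷ p) {i , j} qe with Q? (x , y)
  ... | no ¬q  = trans (restrict-in p qe) (sym (coeff-miss c x y p λ { refl → ¬q qe }))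
  ... | yes _ with x I.≟ i | y I.≟ j
  ...   | yes _ | yes _ = cong (λ z → c I.+ z) (restrict-in p qe)
  ...   | yes _ | no _  = restrict-in p qe
  ...   | no _  | yes _ = restrict-in p qe
  ...   | no _  | no _  = restrict-in p qe

  restrict-all : ∀ p → All (Q ∘ exponent) (restrict p)
  restrict-all = all-filter (Q? ∘ exponent)

  restrict-out : ∀ p {e} → ¬ Q e → coeffAt (restrict p) e ≡ 0ℤ
  restrict-out p {e} ¬q with support Q (restrict p) (restrict-all p) e
  ... | inj₁ q  = ⊥-elim (¬q q)
  ... | inj₂ eq = eq

-- Leading terms for one order

module Leading (O : AdditiveOrder _⊞_) where
  open AdditiveOrder O hiding (≺-irrefl)

  record Lead (p : LPoly) (e : Exponent) : Set where
    constructor lead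
    field
      nonzero : coeffAt p e ≢ 0ℤ
      above   : ∀ {d} → e ≺ d → coeffAt p d ≡ 0ℤ
  open Lead public

  Lead-resp : ∀ {p r e} → p ≋ r → Lead p e → Lead r e
  Lead-resp p≋r (lead nz ab) = lead (λ eq → nz (trans (at p≋r _ _) eq))
                                    (λ e≺d → trans (sym (at p≋r _ _)) (ab e≺d))

  Lead-≼ : ∀ {p e d} → Lead p e → coeffAt p d ≢ 0ℤ → d ≡ e ⊎ d ≺ e
  Lead-≼ {p} {e} {d} l nz with compare d e
  ... | tri< d≺e _ _ = inj₂ d≺e
  ... | tri≈ _ d≡e _ = inj₁ d≡e
  ... | tri> _ _ e≺d = ⊥-elim (nz (above l e≺d))

  Lead-unique : ∀ {p e d} → Lead p e → Lead p d → e ≡ d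
  Lead-unique l m with Lead-≼ l (nonzero m)
  ... | inj₁ d≡e = sym d≡e
  ... | inj₂ d≺e = ⊥-elim (nonzero l (above m d≺e))

  private
    _≺?_ : ∀ d e → Dec (d ≺ e)
    d ≺? e with compare d e
    ... | tri< d≺e _ _ = yes d≺e
    ... | tri≈ d⊀e _ _ = no d⊀e
    ... | tri> d⊀e _ _ = no d⊀e

    below : Exponent → LPoly → LPoly
    below e = restrict (_≺ e) (_≺? e)

    -- The list p may contain terms above e that cancel each other. This equal list contains none,
    -- so that induction over its terms becomes possible.
    split : ∀ {p e} → Lead p e → p ≋ monAt (coeffAt p e) e ⊕ below e p
    split {p} {e} l = mk λ i j → sym (trans (coeff-⊕ (monAt (coeffAt p e) e) (below e p) i j) (parts (i , j)))
      where
      parts : ∀ d → coeffAt (monAt (coeffAt p e) e) d I.+ coeffAt (below e p) d ≡ coeffAt p d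
      parts d with compare d e
      ... | tri< d≺e d≢e _ = trans (cong₂ I._+_ (coeffAt-mon-miss _ (d≢e ∘ sym)) (restrict-in _ (_≺? e) p d≺e))
                                   (I.+-identityˡ _)
      ... | tri≈ d⊀e refl _ = trans (cong₂ I._+_ (coeffAt-mon-hit _ d) (restrict-out _ (_≺? e) p d⊀e))
                                    (I.+-identityʳ _)
      ... | tri> d⊀e d≢e e≺d = trans (cong₂ I._+_ (coeffAt-mon-miss _ (d≢e ∘ sym)) (restrict-out _ (_≺? e) p d⊀e))
                                     (sym (above l e≺d))

    ≺-⊟ : ∀ {d e f} → e ⊞ d ≺ f → d ≺ f ⊟ e
    ≺-⊟ {d@(i , j)} {e@(k , l)} {f@(m , n)} lt = subst₂ _≺_ (d⊞e⊟d≡e e d) refl (≺-mono (I.- k , I.- l) lt)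

    -- A term of exponent below e can reach f only through a coefficient of r above d, and that
    -- coefficient is zero.
    below⊗-vanishes : ∀ {e d f} p r → All ((_≺ e) ∘ exponent) p → (∀ {d′} → d ≺ d′ → coeffAt r d′ ≡ 0ℤ) →
      e ⊞ d ≡ f ⊎ e ⊞ d ≺ f → coeffAt (p ⊗ r) f ≡ 0ℤ
    below⊗-vanishes []             r []       ab le = refl
    below⊗-vanishes {e} {d} {f@(i , j)} (tm c x y ∷ p) r (t≺e ∷ ps) ab le = begin
      coeff ((tm c x y ∷ p) ⊗ r) i j                               ≡⟨ coeff-∷⊗ c x y p r i j ⟩
      c I.* coeff r (i I.- x) (j I.- y) I.+ coeff (p ⊗ r) i j
        ≡⟨ cong₂ (λ u v → c I.* u I.+ v) (ab (≺-⊟ (step le))) (below⊗-vanishes p r ps ab le) ⟩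
      c I.* 0ℤ I.+ 0ℤ                                              ≡⟨ I.+-identityʳ (c I.* 0ℤ) ⟩
      c I.* 0ℤ                                                     ≡⟨ I.*-zeroʳ c ⟩
      0ℤ                                                           ∎
      where
      open ≡-Reasoning
      step : e ⊞ d ≡ f ⊎ e ⊞ d ≺ f → (x , y) ⊞ d ≺ f
      step (inj₁ refl) = ≺-mono d t≺e
      step (inj₂ lt)   = ≺-trans (≺-mono d t≺e) lt

    coeffAt-Lead⊗ : ∀ {p r e d f} → Lead p e → Lead r d → e ⊞ d ≡ f ⊎ e ⊞ d ≺ f →
      coeffAt (p ⊗ r) f ≡ coeffAt p e I.* coeffAt r (f ⊟ e)
    coeffAt-Lead⊗ {p} {r} {e} {d} {f} l m le = begin
      coeffAt (p ⊗ r) f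
        ≡⟨ at (≋-trans (⊗-congˡ r (split l)) (⊗-distribʳ r (monAt (coeffAt p e) e) (below e p))) _ _ ⟩
      coeffAt (monAt (coeffAt p e) e ⊗ r ⊕ below e p ⊗ r) f
        ≡⟨ coeffAt-⊕ (monAt (coeffAt p e) e ⊗ r) (below e p ⊗ r) f ⟩
      coeffAt (monAt (coeffAt p e) e ⊗ r) f I.+ coeffAt (below e p ⊗ r) f
        ≡⟨ cong₂ I._+_ (coeffAt-monAt⊗ (coeffAt p e) e r f)
                       (below⊗-vanishes (below e p) r (restrict-all _ (_≺? e) p) (above m) le) ⟩
      coeffAt p e I.* coeffAt r (f ⊟ e) I.+ 0ℤ
        ≡⟨ I.+-identityʳ _ ⟩
      coeffAt p e I.* coeffAt r (f ⊟ e) ∎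
      where open ≡-Reasoning

  leadingCoeff-⊗ : ∀ {p r e d} → Lead p e → Lead r d →
    coeffAt (p ⊗ r) (e ⊞ d) ≡ coeffAt p e I.* coeffAt r d
  leadingCoeff-⊗ {p} {r} {e} {d} l m =
    trans (coeffAt-Lead⊗ l m (inj₁ refl)) (cong (λ z → coeffAt p e I.* coeffAt r z) (d⊞e⊟d≡e e d))

  Lead-⊗ : ∀ {p r e d} → Lead p e → Lead r d → Lead (p ⊗ r) (e ⊞ d)
  Lead-⊗ {p} {r} {e} {d} l m = lead nz ab
    where
    nz : coeffAt (p ⊗ r) (e ⊞ d) ≢ 0ℤ
    nz eq with I.i*j≡0⇒i≡0∨j≡0 (coeffAt p e) (trans (sym (leadingCoeff-⊗ l m)) eq)
    ... | inj₁ z = nonzero l z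
    ... | inj₂ z = nonzero m z
    ab : ∀ {f} → e ⊞ d ≺ f → coeffAt (p ⊗ r) f ≡ 0ℤ
    ab {f} lt = trans (coeffAt-Lead⊗ l m (inj₂ lt))
      (trans (cong (λ z → coeffAt p e I.* z) (above m (≺-⊟ lt))) (I.*-zeroʳ (coeffAt p e)))

  private
    -- The scan runs over the terms of r but reads coefficients in all of p, since a listed term may
    -- be cancelled by others.
    maximal : ∀ p r → All (λ t → coeffAt p (exponent t) ≡ 0ℤ) r ⊎
      ∃ λ e → coeffAt p e ≢ 0ℤ × All (λ t → e ≺ exponent t → coeffAt p (exponent t) ≡ 0ℤ) r
    maximal p []      = inj₁ []
    maximal p (t ∷ r) with coeffAt p (exponent t) I.≟ 0ℤ | maximal p r
    ... | yes z | inj₁ zs            = inj₁ (z ∷ zs)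
    ... | yes z | inj₂ (e , nz , ab) = inj₂ (e , nz , (λ _ → z) ∷ ab)
    ... | no nz | inj₁ zs            = inj₂ (exponent t , nz , (λ lt → ⊥-elim (≺-irrefl O lt)) ∷ map (λ z _ → z) zs)
    ... | no nz | inj₂ (e , nz′ , ab) with compare e (exponent t)
    ...   | tri< e≺t _ _ = inj₂ (exponent t , nz , (λ lt → ⊥-elim (≺-irrefl O lt)) ∷ map (λ k lt → k (≺-trans e≺t lt)) ab)
    ...   | tri≈ e⊀t _ _ = inj₂ (e , nz′ , (λ lt → ⊥-elim (e⊀t lt)) ∷ ab)
    ...   | tri> e⊀t _ _ = inj₂ (e , nz′ , (λ lt → ⊥-elim (e⊀t lt)) ∷ ab)

  zero-or-Lead : ∀ p → p ≋ [] ⊎ ∃ (Lead p)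
  zero-or-Lead p with maximal p p
  ... | inj₁ zs            = inj₁ (mk λ i j → all-zero (i , j))
    where
    all-zero : ∀ d → coeffAt p d ≡ 0ℤ
    all-zero d with support (λ d → coeffAt p d ≡ 0ℤ) p zs d
    ... | inj₁ z = z
    ... | inj₂ z = z
  ... | inj₂ (e , nz , ab) = inj₂ (e , lead nz zero-above)
    where
    zero-above : ∀ {d} → e ≺ d → coeffAt p d ≡ 0ℤ
    zero-above {d} lt with support (λ d → e ≺ d → coeffAt p d ≡ 0ℤ) p ab d
    ... | inj₁ k = k lt
    ... | inj₂ z = z

  Lead-regular : ∀ {p e} → Lead p e → ∀ r → p ⊗ r ≋ [] → r ≋ []
  Lead-regular l r pr≋0 with zero-or-Lead r
  ... | inj₁ r≋0     = r≋0
  ... | inj₂ (d , m) = ⊥-elim (nonzero (Lead-⊗ l m) (at pr≋0 _ _))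

  Lead-factor : ∀ {u v w e} → u ⊗ v ≋ w → Lead w e → ∃ (Lead u)
  Lead-factor {u} {v} {w} uv≋w l with zero-or-Lead u
  ... | inj₂ found = found
  ... | inj₁ u≋0   = ⊥-elim (nonzero l (at (≋-trans (≋-sym uv≋w) (⊗-congˡ v u≋0)) _ _))

  private
    ≺⇒≢ : ∀ {x y} → x ≺ y → x ≢ y
    ≺⇒≢ x≺x refl = ≺-irrefl O x≺x

  coeff-two : ∀ c d {e f} → f ≺ e → coeffAt (monAt c e ⊕ monAt d f) e ≡ c
  coeff-two c d {e} {f} f≺e = trans (coeffAt-⊕ (monAt c e) (monAt d f) e)
    (trans (cong₂ I._+_ (coeffAt-mon-hit c e) (coeffAt-mon-miss d (≺⇒≢ f≺e))) (I.+-identityʳ c))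

  Lead-two : ∀ {c} d {e f} → c ≢ 0ℤ → f ≺ e → Lead (monAt c e ⊕ monAt d f) e
  Lead-two {c} d {e} {f} c≢0 f≺e = lead
    (λ eq → c≢0 (trans (sym (coeff-two c d f≺e)) eq))
    (λ {g} e≺g → trans (coeffAt-⊕ (monAt c e) (monAt d f) g)
      (cong₂ I._+_ (coeffAt-mon-miss c (≺⇒≢ e≺g)) (coeffAt-mon-miss d (≺⇒≢ (≺-trans f≺e e≺g)))))

  Lead-mon : ∀ {c} e → c ≢ 0ℤ → Lead (monAt c e) e
  Lead-mon {c} e c≢0 = lead (λ eq → c≢0 (trans (sym (coeffAt-mon-hit c e)) eq))
                            (λ {d} e≺d → coeffAt-mon-miss c {e} {d} λ { refl → ≺-irrefl O e≺d })

open Leading using (Lead; nonzero)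

-- Comparing leading terms for different orders

module SameLeading (O O′ : AdditiveOrder _⊞_) where
  private
    module L  = Leading O
    module L′ = Leading O′
    module O = AdditiveOrder O

  SameLead : LPoly → Set
  SameLead p = ∃ λ e → Lead O p e × Lead O′ p e

  SameLead-resp : ∀ {p r} → p ≋ r → SameLead p → SameLead r
  SameLead-resp p≋r (e , l , l′) = e , L.Lead-resp p≋r l , L′.Lead-resp p≋r l′

  SameLead-⊗ : ∀ {p r} → SameLead p → SameLead r → SameLead (p ⊗ r)
  SameLead-⊗ (e , l , l′) (d , m , m′) = e ⊞ d , L.Lead-⊗ l m , L′.Lead-⊗ l′ m′

  -- The O′-leading exponents of u and v are bounded by the O-leading ones, and the two sums agree.
  SameLead-factor : ∀ {u v w} → u ⊗ v ≋ w → SameLead w → SameLead u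
  SameLead-factor {u} {v} {w} uv≋w (f , k , k′)
    with L.Lead-factor {u} {v} uv≋w k | L′.Lead-factor {u} {v} uv≋w k′
       | L.Lead-factor {v} {u} (≋-trans (⊗-comm v u) uv≋w) k | L′.Lead-factor {v} {u} (≋-trans (⊗-comm v u) uv≋w) k′
  ... | e , l | e′ , l′ | d , m | d′ , m′
    with L.Lead-≼ l (nonzero l′) | L.Lead-≼ m (nonzero m′)
  ... | inj₁ refl | _ = e , l , l′
  ... | inj₂ e′≺e | d′≼d = ⊥-elim (≺-irrefl O (subst₂ O._≺_ same refl (strict d′≼d)))
    where
    same : e′ ⊞ d′ ≡ e ⊞ d
    same = trans (L′.Lead-unique (L′.Lead-resp uv≋w (L′.Lead-⊗ l′ m′)) k′)
                 (L.Lead-unique k (L.Lead-resp uv≋w (L.Lead-⊗ l m)))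
    strict : d′ ≡ d ⊎ d′ O.≺ d → e′ ⊞ d′ O.≺ e ⊞ d
    strict (inj₁ refl) = O.≺-mono d e′≺e
    strict (inj₂ lt)   = O.≺-trans (O.≺-mono d′ e′≺e) (subst₂ O._≺_ (⊞-comm d′ e) (⊞-comm d e) (O.≺-mono e lt))

descending : AdditiveOrder I._+_
descending = opposite ascending

O₊₊ O₋₊ O₊₋ : AdditiveOrder _⊞_
O₊₊ = lex ascending ascending
O₋₊ = lex descending ascending
O₊₋ = lex ascending descending

-- For `QLead` the highest and lowest exponents of a coincide: the polynomial is a power of a times
-- a polynomial in q. For `ALead` the highest and lowest exponents of q in the top coefficient of a
-- coincide: that coefficient is an integer times a power of q.
module QLead = SameLeading O₊₊ O₋₊
module ALead = SameLeading O₊₊ O₊₋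
module L₊₊ = Leading O₊₊

-- This condition excludes integer factors, which the two `SameLead` conditions cannot see.
UnitLead : LPoly → Set
UnitLead p = ∃ λ e → Lead O₊₊ p e × I.∣ coeffAt p e ∣ ≡ 1

UnitLead-resp : ∀ {p r} → p ≋ r → UnitLead p → UnitLead r
UnitLead-resp p≋r (e , l , 1ₑ) = e , L₊₊.Lead-resp p≋r l , trans (cong I.∣_∣ (sym (at p≋r _ _))) 1ₑ

UnitLead-⊗ : ∀ {p r} → UnitLead p → UnitLead r → UnitLead (p ⊗ r)
UnitLead-⊗ {p} {r} (e , l , 1ₑ) (d , m , 1d) = e ⊞ d , L₊₊.Lead-⊗ l m ,
  trans (cong I.∣_∣ (L₊₊.leadingCoeff-⊗ l m)) (trans (I.∣i*j∣≡∣i∣*∣j∣ (coeffAt p e) (coeffAt r d)) (cong₂ ℕ._*_ 1ₑ 1d))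

UnitLead-factor : ∀ {u v w} → u ⊗ v ≋ w → UnitLead w → UnitLead u
UnitLead-factor {u} {v} {w} uv≋w (f , k , 1f)
  with L₊₊.Lead-factor {u} {v} uv≋w k | L₊₊.Lead-factor {v} {u} (≋-trans (⊗-comm v u) uv≋w) k
... | e , l | d , m with L₊₊.Lead-unique k (L₊₊.Lead-resp uv≋w (L₊₊.Lead-⊗ l m))
... | refl = e , l , ℕ.m*n≡1⇒m≡1 _ _ (begin
  I.∣ coeffAt u e ∣ ℕ.* I.∣ coeffAt v d ∣   ≡⟨ I.∣i*j∣≡∣i∣*∣j∣ (coeffAt u e) (coeffAt v d) ⟨
  I.∣ coeffAt u e I.* coeffAt v d ∣         ≡⟨ cong I.∣_∣ (L₊₊.leadingCoeff-⊗ l m) ⟨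
  I.∣ coeffAt (u ⊗ v) (e ⊞ d) ∣             ≡⟨ cong I.∣_∣ (at uv≋w _ _) ⟩
  I.∣ coeffAt w (e ⊞ d) ∣                   ≡⟨ 1f ⟩
  1                                         ∎)
  where open ≡-Reasoning

-- No exponent of p exceeds e in any of the three orders. `O₊₊` and `O₋₊` together fix the exponent
-- of a, and then `O₊₊` and `O₊₋` fix that of q.
leads⇒monomial : ∀ {p} → QLead.SameLead p → ALead.SameLead p →
  ∃ λ e → Lead O₊₊ p e × p ≋ monAt (coeffAt p e) e
leads⇒monomial {p} (e , l , l₋₊) (e′ , l′ , l₊₋) with L₊₊.Lead-unique l l′
... | refl = e , l , mk λ i j → equal (i , j)
  where
  only : ∀ {d} → coeffAt p d ≢ 0ℤ → d ≡ e
  only nz with L₊₊.Lead-≼ l nz | Leading.Lead-≼ O₋₊ l₋₊ nz | Leading.Lead-≼ O₊₋ l₊₋ nz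
  ... | inj₁ d≡e            | _                    | _                    = d≡e
  ... | _                   | inj₁ d≡e             | _                    = d≡e
  ... | _                   | _                    | inj₁ d≡e             = d≡e
  ... | inj₂ (inj₁ lt)      | inj₂ (inj₁ gt)       | _                    = ⊥-elim (I.<-asym lt gt)
  ... | inj₂ (inj₁ lt)      | inj₂ (inj₂ (refl , _)) | _                  = ⊥-elim (I.<-irrefl refl lt)
  ... | inj₂ (inj₂ (refl , _)) | _                 | inj₂ (inj₁ lt)       = ⊥-elim (I.<-irrefl refl lt)
  ... | inj₂ (inj₂ (_ , lt)) | _                   | inj₂ (inj₂ (_ , gt)) = ⊥-elim (I.<-asym lt gt)
  equal : ∀ d → coeffAt p d ≡ coeffAt (monAt (coeffAt p e) e) d
  equal d with coeffAt p d I.≟ 0ℤ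
  ... | no nz = trans (cong (coeffAt p) (only nz)) (sym (trans (cong (coeffAt (monAt _ e)) (only nz)) (coeffAt-mon-hit _ e)))
  ... | yes z = trans z (sym (coeffAt-mon-miss (coeffAt p e) {e} {d} λ { refl → nonzero l z }))

unit-monomial : ∀ {c} e → I.∣ c ∣ ≡ 1 → ∀ {p} → p ≋ monAt c e → p ∣ₚ one
unit-monomial {c} (i , j) 1c {p} p≋ = mon c (I.- i) (I.- j) , at (≋-trans (⊗-congˡ (mon c (I.- i) (I.- j)) p≋) (≋-reflexive eq))
  where
  square : ∀ c → I.∣ c ∣ ≡ 1 → c I.* c ≡ 1ℤ
  square (+ .1) refl = refl
  square I.-[1+ .0 ] refl = refl
  eq : mon c i j ⊗ mon c (I.- i) (I.- j) ≡ one
  eq = trans (cong (λ z → mon z _ _) (square c 1c)) (cong₂ (mon 1ℤ) (I.+-inverseʳ i) (I.+-inverseʳ j))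

common-divisor-unit : ∀ {c f g h} → QLead.SameLead f → ALead.SameLead g → UnitLead h →
  c ∣ₚ f → c ∣ₚ g → c ∣ₚ h → c ∣ₚ one
common-divisor-unit {c} qf ag uh (r , cr≈f) (s , cs≈g) (t , ct≈h)
  with leads⇒monomial {c} (QLead.SameLead-factor {c} {r} (mk cr≈f) qf) (ALead.SameLead-factor {c} {s} (mk cs≈g) ag)
     | UnitLead-factor {c} {t} (mk ct≈h) uh
... | e , l , c≋ | e′ , l′ , 1c with L₊₊.Lead-unique l l′
... | refl = unit-monomial e 1c c≋

-- The closed form of the partial sums

constants : I.+-*-rawRing -Raw-AlmostCommutative⟶ fromCommutativeRing laurentRing
constants = record
  { ⟦_⟧    = λ c → mon c 0ℤ 0ℤ
  ; +-homo = λ c d → mk (sum c d)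
  ; *-homo = λ c d → ≋-refl
  ; -‿homo = λ c → ≋-refl
  ; 0-homo = mk zero′
  ; 1-homo = ≋-refl
  }
  where
  origin? : ∀ i j → (0ℤ , 0ℤ) ≡ (i , j) ⊎ (0ℤ , 0ℤ) ≢ (i , j)
  origin? i j with 0ℤ I.≟ i | 0ℤ I.≟ j
  ... | yes refl | yes refl = inj₁ refl
  ... | no 0≢i   | _        = inj₂ λ { refl → 0≢i refl }
  ... | yes _    | no 0≢j   = inj₂ λ { refl → 0≢j refl }
  sum : ∀ c d → mon (c I.+ d) 0ℤ 0ℤ ≈ₚ mon c 0ℤ 0ℤ ⊕ mon d 0ℤ 0ℤ
  sum c d i j with origin? i j
  ... | inj₁ refl = I.+-assoc c d 0ℤ
  ... | inj₂ 0≢e  = trans (coeff-miss (c I.+ d) 0ℤ 0ℤ [] 0≢e)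
                          (sym (trans (coeff-miss c 0ℤ 0ℤ (mon d 0ℤ 0ℤ) 0≢e) (coeff-miss d 0ℤ 0ℤ [] 0≢e)))
  zero′ : mon 0ℤ 0ℤ 0ℤ ≈ₚ []
  zero′ i j with origin? i j
  ... | inj₁ refl = refl
  ... | inj₂ 0≢e  = coeff-miss 0ℤ 0ℤ 0ℤ [] 0≢e

-- Opaque, so that type checking does not multiply out closed Laurent polynomials.
opaque
  q t a b : LPoly
  q = qpow (+ 1)
  t = qpow I.-1ℤ
  a = mon 1ℤ 0ℤ 1ℤ
  b = mon 1ℤ 0ℤ I.-1ℤ

  q≋ : q ≋ qpow (+ 1)
  q≋ = ≋-refl

  t≋ : t ≋ qpow I.-1ℤ
  t≋ = ≋-refl

  a≋ : a ≋ mon 1ℤ 0ℤ 1ℤ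
  a≋ = ≋-refl

  b≋ : b ≋ mon 1ℤ 0ℤ I.-1ℤ
  b≋ = ≋-refl

  tq≋1 : t ⊗ q ≋ one
  tq≋1 = ≋-refl

  ab≋1 : a ⊗ b ≋ one
  ab≋1 = ≋-refl

private module R = CommutativeRing laurentRing
open QSeries laurentRing constants
open Telescoping q t a b tq≋1 ab≋1
open import Algebra.Properties.Semiring.Exp R.semiring using (_^_; ^-congˡ)

mon-≡ : ∀ {i i′ j j′} → i ≡ i′ → j ≡ j′ → mon 1ℤ i j ≋ mon 1ℤ i′ j′
mon-≡ refl refl = ≋-refl

qpow-^ : ∀ d k → qpow (+ d) ^ k ≋ qpow (+ (d ℕ.* k))
qpow-^ d zero    = mon-≡ (cong +_ (sym (ℕ.*-zeroʳ d))) refl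
qpow-^ d (suc k) = ≋-trans (⊗-congʳ (qpow (+ d)) (qpow-^ d k)) (mon-≡ (cong +_ (sym (ℕ.*-suc d k))) refl)

q^ : ∀ k → q ^ k ≋ qpow (+ k)
q^ k = ≋-trans (^-congˡ k q≋) (≋-trans (qpow-^ 1 k) (mon-≡ (cong +_ (ℕ.*-identityˡ k)) refl))

p^ : ∀ k → p ^ k ≋ qpow (+ (4 ℕ.* k))
p^ k = ≋-trans (^-congˡ k (q^ 4)) (qpow-^ 4 k)

x^ : ∀ k → x ^ k ≋ qpow (+ (2 ℕ.* k))
x^ k = ≋-trans (^-congˡ k (q^ 2)) (qpow-^ 2 k)

r≋ : r ≋ qpow (I.- + 2)
r≋ = ^-congˡ 2 t≋

times-mon : ∀ {u v i j k l} → u ≋ mon 1ℤ i j → v ≋ mon 1ℤ k l → u ⊗ v ≋ mon 1ℤ (i I.+ k) (j I.+ l)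
times-mon u≋ v≋ = ⊗-cong u≋ v≋

times-p^ : ∀ {u i j} → u ≋ mon 1ℤ i j → ∀ k → u ⊗ p ^ k ≋ mon 1ℤ (i I.+ + (4 ℕ.* k)) j
times-p^ {j = j} u≋ k = ≋-trans (times-mon u≋ (p^ k)) (mon-≡ refl (I.+-identityʳ j))

poch≋qPoch : ∀ {u i j} → u ≋ mon 1ℤ i j → ∀ k → poch i j 4 k ≋ qPoch u p k
poch≋qPoch u≋ zero    = ≋-refl
poch≋qPoch u≋ (suc k) = ⊗-cong (poch≋qPoch u≋ k) (1-cong (≋-sym (times-p^ u≋ k)))

poch≋pochs : ∀ {u i} → u ≋ qpow i → ∀ k →
  poch i 0ℤ 4 k ⊗ poch i 0ℤ 4 k ⊗ poch i I.-1ℤ 4 k ⊗ poch i 1ℤ 4 k ≋ pochs u k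
poch≋pochs {u} {i} u≋ k =
  ⊗-cong (⊗-cong (⊗-cong (poch≋qPoch u≋ k) (poch≋qPoch u≋ k)) (poch≋qPoch (shift b≋) k)) (poch≋qPoch (shift a≋) k)
  where
  shift : ∀ {c j} → c ≋ mon 1ℤ 0ℤ j → u ⊗ c ≋ mon 1ℤ i j
  shift {j = j} c≋ = ≋-trans (times-mon u≋ c≋) (mon-≡ (I.+-identityʳ i) (I.+-identityˡ j))

geom≋qint2 : ∀ n → geom x n ≋ qint2 n
geom≋qint2 zero    = ≋-refl
geom≋qint2 (suc n) = ⊕-cong (geom≋qint2 n) (x^ n)

4[1+k]-1 : ∀ k → + (4 ℕ.* suc k) I.- + 1 ≡ + 3 I.+ + (4 ℕ.* k)
4[1+k]-1 k = trans (cong (λ z → + z I.- + 1) (ℕ.*-suc 4 k)) (lemma (+ (4 ℕ.* k)))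
  where
  lemma : ∀ y → + 4 I.+ y I.- + 1 ≡ + 3 I.+ y
  lemma = I.solve-∀

summand-den : ∀ k → den (summand k) ≋ summandDen k
summand-den k = ⊗-cong (⊗-cong (⊗-cong (1-cong (≋-sym (q^ 2))) (1-cong (≋-sym q≋))) (1-cong (≋-sym q≋))) (poch≋pochs (q^ 4) k)

summand-num : ∀ k → num (summand (suc k)) ≋ summandNum k
summand-num k = ⊗-cong (⊗-cong (⊗-cong (1-cong six) (1-cong three)) (1-cong three))
                       (⊗-cong (poch≋pochs r≋ (suc k)) (≋-sym (p^ (suc k))))
  where
  double : ∀ y → + 2 I.* (+ 3 I.+ y) ≡ + 6 I.+ (y I.+ y)
  double = I.solve-∀
  six : qpow (+ 2 I.* (+ (4 ℕ.* suc k) I.- + 1)) ≋ q ^ 6 ⊗ (p ^ k ⊗ p ^ k)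
  six = ≋-trans (mon-≡ (trans (cong (+ 2 I.*_) (4[1+k]-1 k)) (double (+ (4 ℕ.* k)))) refl)
                (≋-sym (times-mon (q^ 6) (times-mon (p^ k) (p^ k))))
  three : qpow (+ 1 I.* (+ (4 ℕ.* suc k) I.- + 1)) ≋ q ^ 3 ⊗ p ^ k
  three = ≋-trans (mon-≡ (trans (I.*-identityˡ _) (4[1+k]-1 k)) refl) (≋-sym (times-mon (q^ 3) (p^ k)))

summand-num₀ : num (summand 0) ≋ summandNum₀
summand-num₀ = ⊗-congˡ (one ⊗ one ⊗ one ⊗ one ⊗ one)
  (⊗-cong (⊗-cong (1-cong (≋-sym r≋)) (1-cong (≋-sym t≋))) (1-cong (≋-sym t≋)))

closed-form : ∀ M → num (sumTo M) ⊗ closedDen M ≋ closedNum M ⊗ den (sumTo M)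
closed-form zero    =
  ≋-trans (⊗-congˡ (closedDen 0) summand-num₀) (≋-trans closed-zero (⊗-congʳ (closedNum 0) (≋-sym (summand-den 0))))
closed-form (suc M) =
  ≋-trans (⊗-congˡ (closedDen (suc M)) (⊕-cong (⊗-congʳ (num (sumTo M)) (summand-den (suc M))) (⊗-congˡ (den (sumTo M)) (summand-num M))))
  (≋-trans (closed-suc M (num (sumTo M)) (den (sumTo M)) (closed-form M))
           (⊗-congʳ (closedNum (suc M)) (⊗-congʳ (den (sumTo M)) (≋-sym (summand-den (suc M))))))

-- Coprimality

Regular-mon : ∀ i j → Regular (mon 1ℤ i j)
Regular-mon i j = L₊₊.Lead-regular (L₊₊.Lead-mon {1ℤ} (i , j) λ ())

Regular-1-mon : ∀ {u i j} → u ≋ mon 1ℤ i j → (i , j) ≢ (0ℤ , 0ℤ) → Regular (one ⊖ u)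
Regular-1-mon {u} {i} {j} u≋ e≢0 = Regular-resp (1-cong (≋-sym u≋)) (proof (AdditiveOrder.compare O₊₊ (i , j) (0ℤ , 0ℤ)))
  where
  proof : _ → Regular (one ⊖ mon 1ℤ i j)
  proof (tri< lt _ _) = L₊₊.Lead-regular (L₊₊.Lead-two {1ℤ} I.-1ℤ {0ℤ , 0ℤ} {i , j} (λ ()) lt)
  proof (tri≈ _ eq _) = ⊥-elim (e≢0 eq)
  proof (tri> _ _ gt) = Regular-resp (⊕-comm (mon I.-1ℤ i j) one)
                                     (L₊₊.Lead-regular (L₊₊.Lead-two {I.-1ℤ} 1ℤ {i , j} {0ℤ , 0ℤ} (λ ()) gt))

regular-x : ∀ j → Regular (one ⊖ x ^ suc j)
regular-x j = Regular-1-mon (x^ (suc j)) λ ()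

open Divisibility regular-x
open Binomial x regular-x

pochs-p-factor : ∀ {c j} → c ≋ mon 1ℤ 0ℤ j → ∀ k → p ⊗ c ⊗ p ^ k ≋ mon 1ℤ (+ (4 ℕ.+ 4 ℕ.* k)) j
pochs-p-factor {j = j} c≋ = times-p^ (≋-trans (times-mon (q^ 4) c≋) (mon-≡ refl (I.+-identityˡ j)))

closedDen-regular : ∀ k → Regular (closedDen k)
closedDen-regular = Regular-closedDen
  (Regular-1-mon q≋ λ ()) (Regular-resp (≋-sym (q^ 4)) (Regular-mon (+ 4) 0ℤ)) (λ j → Regular-1-mon (times-p^ (q^ 4) j) λ ())
  (Regular-1-mon (times-mon (q^ 2) b≋) λ ()) (Regular-1-mon (times-mon (q^ 2) a≋) λ ())
  (λ j → Regular-1-mon (pochs-p-factor b≋ j) λ ()) (λ j → Regular-1-mon (pochs-p-factor a≋ j) λ ())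

QLead-difference : ∀ {u v i k} → u ≋ qpow i → v ≋ qpow k → i ≢ k → QLead.SameLead (u ⊖ v)
QLead-difference {u} {v} {i} {k} u≋ v≋ i≢k = QLead.SameLead-resp (⊕-cong (≋-sym u≋) (neg-cong (≋-sym v≋))) proof
  where
  proof : QLead.SameLead (qpow i ⊖ qpow k)
  proof with I.<-cmp i k
  ... | tri≈ _ i≡k _ = ⊥-elim (i≢k i≡k)
  ... | tri> _ _ k<i = (i , 0ℤ) , Leading.Lead-two O₊₊ I.-1ℤ (λ ()) (inj₂ (refl , k<i))
                                , Leading.Lead-two O₋₊ I.-1ℤ (λ ()) (inj₂ (refl , k<i))
  ... | tri< i<k _ _ = QLead.SameLead-resp (⊕-comm (mon I.-1ℤ k 0ℤ) (qpow i))
                       ((k , 0ℤ) , Leading.Lead-two O₊₊ 1ℤ (λ ()) (inj₂ (refl , i<k))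
                                 , Leading.Lead-two O₋₊ 1ℤ (λ ()) (inj₂ (refl , i<k)))

QLead-1+x^ : ∀ j → QLead.SameLead (one ⊕ x ^ suc j)
QLead-1+x^ j = QLead.SameLead-resp (≋-trans (⊕-comm (qpow (+ (2 ℕ.* suc j))) one) (⊕-cong (≋-refl {one}) (≋-sym (x^ (suc j)))))
  (_ , Leading.Lead-two O₊₊ 1ℤ (λ ()) (inj₂ (refl , 0<)) , Leading.Lead-two O₋₊ 1ℤ (λ ()) (inj₂ (refl , 0<)))
  where
  0< : 0ℤ I.< + (2 ℕ.* suc j)
  0< = I.+<+ (ℕ.s≤s ℕ.z≤n)

ALead-two : ∀ {c d i j k l} → c ≢ 0ℤ → l I.< j → ALead.SameLead (mon c i j ⊕ mon d k l)
ALead-two {c} {d} {i} {j} c≢0 l<j = (i , j) , Leading.Lead-two O₊₊ d c≢0 (inj₁ l<j) , Leading.Lead-two O₊₋ d c≢0 (inj₁ l<j)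

ALead-mon : ∀ {c} → c ≢ 0ℤ → ALead.SameLead (mon c 0ℤ 0ℤ)
ALead-mon c≢0 = (0ℤ , 0ℤ) , Leading.Lead-mon O₊₊ (0ℤ , 0ℤ) c≢0 , Leading.Lead-mon O₊₋ (0ℤ , 0ℤ) c≢0

UnitLead-two : ∀ {c d e f} → I.∣ c ∣ ≡ 1 → AdditiveOrder._≺_ O₊₊ f e → UnitLead (monAt c e ⊕ monAt d f)
UnitLead-two {c} {d} {e} ∣c∣≡1 f≺e =
  e , L₊₊.Lead-two d (λ { refl → case ∣c∣≡1 }) f≺e , trans (cong I.∣_∣ (L₊₊.coeff-two c d f≺e)) ∣c∣≡1
  where
  case : 0 ≡ 1 → ⊥
  case ()

-- The ideal (d , m) has height two, whence d and m have no common factor.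
-- Unlike coprimality itself this passes to products without unique factorisation.
record Separated (d m : LPoly) : Set where
  field
    {f g} : LPoly
    f∈    : f ∈⟨ d , m ⟩
    g∈    : g ∈⟨ d , m ⟩
    qLead : QLead.SameLead f
    aLead : ALead.SameLead g

Separated-resp : ∀ {d m m′} → m ≋ m′ → Separated d m → Separated d m′
Separated-resp {d} {m} {m′} m≋m′ S = record { f∈ = move f∈ ; g∈ = move g∈ ; qLead = qLead ; aLead = aLead }
  where
  open Separated S
  move : ∀ {f} → f ∈⟨ d , m ⟩ → f ∈⟨ d , m′ ⟩
  move (u , v , eq) = u , v , ≋-trans (⊕-cong (≋-refl {u ⊗ d}) (⊗-congʳ v (≋-sym m≋m′))) eq

Separated-⊗ : ∀ {d e m} → Separated d m → Separated e m → Separated (d ⊗ e) m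
Separated-⊗ S T = record
  { f∈    = ∈-* S.f∈ T.f∈
  ; g∈    = ∈-* S.g∈ T.g∈
  ; qLead = QLead.SameLead-⊗ S.qLead T.qLead
  ; aLead = ALead.SameLead-⊗ S.aLead T.aLead
  }
  where
  module S = Separated S
  module T = Separated T

Separated-∏ : ∀ {m f} → Separated one m → (∀ j → Separated (f j) m) → ∀ k → Separated (∏ f k) m
Separated-∏ S₁ Sf zero    = S₁
Separated-∏ S₁ Sf (suc k) = Separated-⊗ (Separated-∏ S₁ Sf k) (Sf k)

∣ₚ-∈ : ∀ {c d m f} → f ∈⟨ d , m ⟩ → c ∣ₚ d → c ∣ₚ m → c ∣ₚ f
∣ₚ-∈ {c} {d} {m} {f} (u , v , eq) (r , cr≈d) (s , cs≈m) = u ⊗ r ⊕ v ⊗ s , at (begin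
  c ⊗ (u ⊗ r ⊕ v ⊗ s)            ≈⟨ ⊗-distribˡ c (u ⊗ r) (v ⊗ s) ⟩
  c ⊗ (u ⊗ r) ⊕ c ⊗ (v ⊗ s)      ≈⟨ ⊕-cong (exchange u r) (exchange v s) ⟩
  u ⊗ (c ⊗ r) ⊕ v ⊗ (c ⊗ s)      ≈⟨ ⊕-cong (⊗-congʳ u (mk cr≈d)) (⊗-congʳ v (mk cs≈m)) ⟩
  u ⊗ d ⊕ v ⊗ m                  ≈⟨ eq ⟩
  f                              ∎)
  where
  open import Relation.Binary.Reasoning.Setoid R.setoid
  exchange : ∀ w z → c ⊗ (w ⊗ z) ≋ w ⊗ (c ⊗ z)
  exchange w z = ≋-trans (≋-sym (⊗-assoc c w z)) (≋-trans (⊗-congˡ z (⊗-comm c w)) (⊗-assoc w c z))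

Separated⇒Coprime : ∀ {d m} → UnitLead m → Separated d m → Coprime d m
Separated⇒Coprime {d} {m} um S c c∣d c∣m =
  common-divisor-unit {c} {f} {g} {m} qLead aLead um (∣ₚ-∈ {c} {d} {m} f∈ c∣d c∣m) (∣ₚ-∈ {c} {d} {m} g∈ c∣d c∣m) c∣m
  where open Separated S

-- The modulus for n = 2i + 3 and its separation from D

module Modulus (i : ℕ) where

  n : ℕ
  n = suc (suc i ℕ.+ suc i)

  z g m : LPoly
  z = x ^ n
  g = geom x n
  m = g ⊗ g ⊗ (one ⊖ a ⊗ z) ⊗ (a ⊖ z)

  az≋ : a ⊗ z ≋ mon 1ℤ (+ (2 ℕ.* n)) 1ℤ
  az≋ = times-mon a≋ (x^ n)

  m≋modulus : m ≋ modulus n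
  m≋modulus = ⊗-cong (⊗-cong (⊗-cong (geom≋qint2 n) (geom≋qint2 n)) (1-cong az≋)) (⊕-cong a≋ (neg-cong (x^ n)))

  geom⊗1-x : ∀ k → geom x k ⊗ (one ⊖ x) ≋ one ⊖ x ^ k
  geom⊗1-x k = ≋-trans (⊗-comm (geom x k) (one ⊖ x)) (geom-sum x k)

  QLead-geom : ∀ k → QLead.SameLead (geom x (suc k))
  QLead-geom k = QLead.SameLead-factor {geom x (suc k)} {one ⊖ x} (geom⊗1-x (suc k)) (QLead-difference ≋-refl (x^ (suc k)) λ ())

  UnitLead-m : UnitLead m
  UnitLead-m = UnitLead-⊗ (UnitLead-⊗ (UnitLead-⊗ ug ug) uaz) ua-z
    where
    ug : UnitLead g
    -- g divides 1-x^n, whose leading coefficient is -1.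
    ug = UnitLead-factor {g} {one ⊖ x} (geom⊗1-x n) (UnitLead-resp (≋-trans (⊕-comm (mon I.-1ℤ (+ (2 ℕ.* n)) 0ℤ) one) (1-cong (≋-sym (x^ n))))
           (UnitLead-two refl (inj₂ (refl , I.+<+ (ℕ.s≤s ℕ.z≤n)))))
    uaz : UnitLead (one ⊖ a ⊗ z)
    uaz = UnitLead-resp (≋-trans (⊕-comm (mon I.-1ℤ (+ (2 ℕ.* n)) 1ℤ) one) (1-cong (≋-sym az≋)))
            (UnitLead-two refl (inj₁ (I.+<+ (ℕ.s≤s ℕ.z≤n))))
    ua-z : UnitLead (a ⊖ z)
    ua-z = UnitLead-resp (⊕-cong (≋-sym a≋) (neg-cong (≋-sym (x^ n)))) (UnitLead-two refl (inj₁ (I.+<+ (ℕ.s≤s ℕ.z≤n))))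

  -- For factors d of D free of a: d itself is the polynomial in q. Squaring the relation for c
  -- gives c^2 (1-az) (a-z), whose top coefficient in a is -c^2 z, a monomial in q.
  separated-by-constant : ∀ {c d} → c ≢ 0ℤ → QLead.SameLead d → mon c 0ℤ 0ℤ ∈⟨ d , g ⟩ → Separated d m
  separated-by-constant {c} {d} c≢0 qd c∈ = record
    { f∈    = ∈-generator {d} {m}
    ; g∈    = ∈-square {mon c 0ℤ 0ℤ} {d} {g} (one ⊖ a ⊗ z) (a ⊖ z) c∈
    ; qLead = qd
    ; aLead = ALead.SameLead-⊗ (ALead.SameLead-⊗ (ALead.SameLead-⊗ (ALead-mon c≢0) (ALead-mon c≢0)) laz) la-z
    }
    where
    laz : ALead.SameLead (one ⊖ a ⊗ z)
    laz = ALead.SameLead-resp (≋-trans (⊕-comm (mon I.-1ℤ (+ (2 ℕ.* n)) 1ℤ) one) (1-cong (≋-sym az≋)))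
            (ALead-two (λ ()) (I.+<+ (ℕ.s≤s ℕ.z≤n)))
    la-z : ALead.SameLead (a ⊖ z)
    la-z = ALead.SameLead-resp (⊕-cong (≋-sym a≋) (neg-cong (≋-sym (x^ n)))) (ALead-two (λ ()) (I.+<+ (ℕ.s≤s ℕ.z≤n)))

  -- For factors d linear in a or 1/a: now d has the monomial top coefficient, and the modulus at
  -- the zero a = y of d is g^2 (1-yz) (y-z). This is free of a, and nonzero because y is neither z
  -- nor its inverse.
  separated-by-value : ∀ {y e d l} → a ≋ y ⊕ e ⊗ d → y ≋ qpow l → l ≢ I.- + (2 ℕ.* n) → l ≢ + (2 ℕ.* n) →
    ALead.SameLead d → Separated d m
  separated-by-value {y} {e} {d} {l} a≋y+ed y≋ l≢-2n l≢2n ad = record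
    { f∈    = ∈-substitute {a} {y} {e} {d} z (g ⊗ g) a≋y+ed
    ; g∈    = ∈-generator {d} {m}
    ; qLead = QLead.SameLead-⊗ (QLead.SameLead-⊗ (QLead.SameLead-⊗ qg qg)
                (QLead-difference ≋-refl (times-mon y≋ (x^ n)) l+2n≢0)) (QLead-difference y≋ (x^ n) l≢2n)
    ; aLead = ad
    }
    where
    qg : QLead.SameLead g
    qg = QLead-geom (suc i ℕ.+ suc i)
    negate : ∀ l k → l I.+ k I.- k ≡ l
    negate = I.solve-∀
    l+2n≢0 : 0ℤ ≢ l I.+ + (2 ℕ.* n)
    l+2n≢0 eq = l≢-2n (trans (sym (negate l (+ (2 ℕ.* n)))) (trans (cong (λ w → w I.- + (2 ℕ.* n)) (sym eq)) (I.+-identityˡ _)))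

  -- n is odd, so 2n is not divisible by 4. Hence the zeros in a of the denominator factors avoid
  -- q^(2n) and q^(-2n).
  4[1+k]≢2n : ∀ k → 4 ℕ.+ 4 ℕ.* k ≢ 2 ℕ.* n
  4[1+k]≢2n k eq = ℕ.even≢odd (suc k) (suc i) (ℕ.*-cancelˡ-≡ (2 ℕ.* suc k) (suc (2 ℕ.* suc i)) 2 (begin
    2 ℕ.* (2 ℕ.* suc k)       ≡⟨ ℕ.*-assoc 2 2 (suc k) ⟨
    4 ℕ.* suc k               ≡⟨ ℕ.*-suc 4 k ⟩
    4 ℕ.+ 4 ℕ.* k             ≡⟨ eq ⟩
    2 ℕ.* n                   ≡⟨ cong (λ w → 2 ℕ.* suc (suc i ℕ.+ w)) (ℕ.+-identityʳ (suc i)) ⟨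
    2 ℕ.* suc (2 ℕ.* suc i)   ∎))
    where open ≡-Reasoning

  separated-b : ∀ k → Separated (one ⊖ p ⊗ b ⊗ p ^ k) m
  separated-b k = separated-by-value {p ⊗ p ^ k} {a} {one ⊖ p ⊗ b ⊗ p ^ k}
    (a-mod-1-pbY (p ^ k)) (times-p^ (q^ 4) k) (λ ()) (λ eq → 4[1+k]≢2n k (I.+-injective eq))
    (ALead.SameLead-resp (1-cong (≋-sym (pochs-p-factor b≋ k))) (ALead-two (λ ()) I.-<+))

  separated-a : ∀ k → Separated (one ⊖ p ⊗ a ⊗ p ^ k) m
  separated-a k = separated-by-value {y} {neg y} {one ⊖ p ⊗ a ⊗ p ^ k}
    (a-mod-1-paY (p ^ k) y inverse) ≋-refl (λ eq → 4[1+k]≢2n k (I.+-injective (I.neg-injective eq))) (λ ())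
    (ALead.SameLead-resp (≋-trans (⊕-comm (mon I.-1ℤ (+ (4 ℕ.+ 4 ℕ.* k)) 1ℤ) one) (1-cong (≋-sym (pochs-p-factor a≋ k))))
                         (ALead-two (λ ()) (I.+<+ (ℕ.s≤s ℕ.z≤n))))
    where
    y : LPoly
    y = qpow (I.- + (4 ℕ.+ 4 ℕ.* k))
    inverse : y ⊗ (p ⊗ p ^ k) ≋ one
    inverse = ≋-trans (⊗-congʳ y (times-p^ (q^ 4) k)) (mon-≡ (I.+-inverseˡ (+ (4 ℕ.+ 4 ℕ.* k))) refl)

  separated-one : Separated one m
  separated-one = record { f∈ = ∈-generator {one} {m} ; g∈ = ∈-generator {one} {m}
    ; qLead = (0ℤ , 0ℤ) , Leading.Lead-mon O₊₊ (0ℤ , 0ℤ) (λ ()) , Leading.Lead-mon O₋₊ (0ℤ , 0ℤ) (λ ())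
    ; aLead = ALead-mon λ () }

  separated-cofactor : ∀ k → one ∈⟨ geom x (suc k) , g ⟩ → Separated (cofactor (suc k)) m
  separated-cofactor k 1∈ = Separated-⊗ (Separated-⊗ (Separated-⊗ 1-q 1-q) (Separated-⊗ cl cl))
    (Separated-⊗ (Separated-∏ separated-one separated-b (suc k)) (Separated-∏ separated-one separated-a (suc k)))
    where
    1-q : Separated (one ⊖ q) m
    1-q = separated-by-constant {+ n} (λ ()) (QLead-difference ≋-refl q≋ λ ()) (geom-mod-1-q q n)
    signed : Separated (signedPart (suc k)) m
    signed = Separated-∏ separated-one (λ j → separated-by-constant {+ 2} (λ ()) (QLead-1+x^ j) (geom-mod-1+ x (suc j) (suc i))) (suc k)
    cl : Separated (clearing (suc k)) m
    cl = Separated-⊗ (Separated-⊗ signed signed) (separated-by-constant {1ℤ} (λ ()) (QLead-geom k) 1∈)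

  -- The three hypotheses are all that depends on the choice of M. Regularity of `closedDen` allows
  -- the passage from the closed form back to the fraction `sumTo` with its own denominator.
  congruence : ∀ k c → i ℕ.< k → (one ⊖ x ^ suc k) ⊗ qBinomial (suc k) (suc k) ≋ (one ⊖ z) ⊗ c →
    one ∈⟨ geom x (suc k) , g ⟩ → CongZero (sumTo (suc k)) (modulus n)
  congruence k c i<k central 1∈ = N , cofactor M , coprime , at (cancel {closedDen M} (closedDen-regular M)
    (num S ⊗ cofactor M) (modulus n ⊗ N ⊗ den S) (begin
    closedDen M ⊗ (num S ⊗ cofactor M)          ≈⟨ ⊗-assoc (closedDen M) (num S) (cofactor M) ⟨
    closedDen M ⊗ num S ⊗ cofactor M            ≈⟨ ⊗-congˡ (cofactor M) (⊗-comm (closedDen M) (num S)) ⟩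
    num S ⊗ closedDen M ⊗ cofactor M            ≈⟨ ⊗-congˡ (cofactor M) (closed-form M) ⟩
    closedNum M ⊗ den S ⊗ cofactor M            ≈⟨ swap (closedNum M) (den S) (cofactor M) ⟩
    closedNum M ⊗ cofactor M ⊗ den S            ≈⟨ ⊗-congˡ (den S) eq ⟩
    m ⊗ N ⊗ closedDen M ⊗ den S                 ≈⟨ ⊗-congˡ (den S) (⊗-comm (m ⊗ N) (closedDen M)) ⟩
    closedDen M ⊗ (m ⊗ N) ⊗ den S               ≈⟨ ⊗-assoc (closedDen M) (m ⊗ N) (den S) ⟩
    closedDen M ⊗ (m ⊗ N ⊗ den S)               ≈⟨ ⊗-congʳ (closedDen M) (⊗-congˡ (den S) (⊗-congˡ N m≋modulus)) ⟩
    closedDen M ⊗ (modulus n ⊗ N ⊗ den S)       ∎))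
    where
    open import Relation.Binary.Reasoning.Setoid R.setoid
    M : ℕ
    M = suc k
    S : Frac
    S = sumTo M
    N : LPoly
    N = proj₁ (divides i k c i<k central)
    eq : closedNum M ⊗ cofactor M ≋ m ⊗ N ⊗ closedDen M
    eq = proj₂ (divides i k c i<k central)
    swap : ∀ u v w → u ⊗ v ⊗ w ≋ u ⊗ w ⊗ v
    swap u v w = ≋-trans (⊗-assoc u v w) (≋-trans (⊗-congʳ u (⊗-comm v w)) (≋-sym (⊗-assoc u w v)))
    coprime : Coprime (cofactor M) (modulus n)
    coprime = Separated⇒Coprime {cofactor M} {modulus n} (UnitLead-resp m≋modulus UnitLead-m)
      (Separated-resp m≋modulus (separated-cofactor k 1∈))

-- The two choices of M

half : ∀ n → 1 < n → n % 2 ≡ 1 → ∃ λ i → n ≡ suc (suc i ℕ.+ suc i)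
half n 1<n odd with n / 2 | ℕ.m≡m%n+[m/n]*n n 2
... | h | eq with trans eq (cong (ℕ._+ h ℕ.* 2) odd)
half .1 (ℕ.s≤s ()) odd | zero  | eq | refl
half n  1<n        odd | suc i | eq | n≡ = i , trans n≡ (cong suc (trans (ℕ.*-comm (suc i) 2) (cong (suc i ℕ.+_) (ℕ.+-identityʳ (suc i)))))

theorem3p2 : (n M : ℕ) → 1 < n → n % 2 ≡ 1 →
    (M ≡ (n + 1) / 2 ⊎ M ≡ n ∸ 1) →
    CongZero (sumTo M) (modulus n)
theorem3p2 n M 1<n odd choice with half n 1<n odd
theorem3p2 _ M 1<n odd (inj₁ M≡) | i , refl =
  subst (λ M → CongZero (sumTo M) (modulus n)) (sym (trans M≡ [n+1]/2))
    -- Here M = i+2, so n = 2i+3 = 2M-1.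
    (congruence (suc i) ((one ⊕ x ^ suc (suc i)) ⊗ qBinomial (suc i) (suc i)) ℕ.≤-refl
      (central-step (suc i)) (geom-comaximal-half x (suc i)))
  where
  open Modulus i
  double : ∀ k → suc k ℕ.+ suc k ≡ suc k ℕ.* 2
  double k = trans (cong (suc k ℕ.+_) (sym (ℕ.+-identityʳ (suc k)))) (ℕ.*-comm 2 (suc k))
  [n+1]/2 : (n + 1) / 2 ≡ suc (suc i)
  [n+1]/2 = trans (cong (_/ 2) (trans (ℕ.+-comm n 1) (trans (cong suc (sym (ℕ.+-suc (suc i) (suc i)))) (double (suc i)))))
                  (ℕ.m*n/n≡m (suc (suc i)) 2)
theorem3p2 _ _ 1<n odd (inj₂ refl) | i , refl =
  -- Here M = 2i+2, so n = M+1.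
  congruence (i ℕ.+ suc i) (qBinomial (suc (suc (i ℕ.+ suc i))) (i ℕ.+ suc i)) (ℕ.m<m+n i (ℕ.s≤s ℕ.z≤n))
    (central-shift (i ℕ.+ suc i)) (geom-comaximal-suc x (suc i ℕ.+ suc i))
  where open Modulus i
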